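{- Let $n\ge1$ and let $\lambda\in\mathbb{Z}^n$ with $\lambda_1\ge\cdots\ge\lambda_n$. Let $W_\lambda=\{v\in S_n: v\lambda=\lambda\}$ be the stabilizer of $\lambda$ in $S_n$, let $W_\lambda(t)=\sum_{w\in W_\lambda}t^{\ell(w)}$ be its length generating function, and let $w_\lambda$ be the longest element of $W_\lambda$. Then $$t^{ -\frac12\ell(w_\lambda)}W_\lambda(t)=\mathrm{ev}^t_0(c^Y_{w_\lambda})=\sum_{w\in W_\lambda}w\,c^{X^{ -1}}_{w_\lambda}.$$ Alternatively, $$W_\lambda(t)=\sum_{w\in W_\lambda}w\Big(\prod_{1\le i<j\le n,\ \lambda_i=\lambda_j}\frac{1-tx_i^{ -1}x_j}{1-x_i^{ -1}x_j}\Big)=\prod_{1\le i<j\le n,\ \lambda_i=\lambda_j}\frac{1-t^{j-i+1}}{1-t^{j-i}}=\prod_{i\in\mathbb{Z}}[m_i]!,$$ where $m_i=\#\{k\in\{1,\ldots,n\}:\lambda_k=i\}$ and $[m]!=\prod_{d=1}^m\frac{1-t^d}{1-t}$.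
   Context: $t^{1/2}$ is an indeterminate over $\mathbb{C}$, $t=(t^{1/2})^2$; $\ell$ is the length function of $S_n$; $S_n$ acts on $\mathbb{Z}^n$ by permuting positions and on functions of $x_1,\ldots,x_n$ by permuting the variables. In commuting variables $x_1,\ldots,x_n$ and $Y_1,\ldots,Y_n$, $$c^{X^{ -1}}_{w_\lambda}=\prod_{1\le i<j\le n,\ \lambda_i=\lambda_j}\frac{t^{ -\frac12}-t^{\frac12}x_i^{ -1}x_j}{1-x_i^{ -1}x_j},\qquad c^Y_{w_\lambda}=\prod_{1\le i<j\le n,\ \lambda_i=\lambda_j}\frac{t^{ -\frac12}-t^{\frac12}Y_iY_j^{ -1}}{1-Y_iY_j^{ -1}},$$ and $\mathrm{ev}^t_0$ is the evaluation $Y_i\mapsto t^{ -(i-1)+\frac12(n-1)}$. -}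

module Defs where

open import Level using (_⊔_)
open import Algebra.Bundles using (CommutativeRing)
open import Algebra.Morphism.Structures using (IsRingHomomorphism)
import Algebra.Morphism.Construct.Composition as Composition
import Algebra.Properties.CommutativeMonoid.Sum as MonoidSum
import Algebra.Properties.Ring as RingProperties
import Algebra.Properties.Semiring.Exp as Exp
open import Data.Fin as Fin using (Fin; zero; suc; toℕ)
import Data.Fin.Properties as Fin
open import Data.Fin.Permutation as Perm using (Permutation′; _⟨$⟩ʳ_; _⟨$⟩ˡ_)
open import Data.Integer as ℤ using (ℤ; +_; -[1+_])
import Data.Integer.Properties as ℤ
open import Data.List using (List; []; _∷_; map; foldr; filter; length; allFin; concatMap; cartesianProduct; deduplicate; tabulate)
open import Data.List.Membership.Propositional using (_∉_)
import Data.List.Membership.Propositional.Properties as Mem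
open import Data.List.Properties using (filter-none)
open import Data.List.Relation.Unary.All as All using (All; []; _∷_)
import Data.List.Relation.Unary.All.Properties as All
open import Data.List.Relation.Unary.AllPairs as AllPairs using (AllPairs; []; _∷_)
import Data.List.Relation.Unary.AllPairs.Properties as AllPairs
open import Data.List.Relation.Unary.Any as Any using (Any; here)
import Data.List.Relation.Unary.Any.Properties as Any
open import Data.List.Relation.Unary.Unique.Propositional using (Unique)
open import Data.List.Relation.Unary.Unique.DecPropositional.Properties using (deduplicate-!)

import Data.List.Relation.Unary.Unique.Propositional.Properties as Unique
open import Data.Nat as ℕ using (ℕ; zero; suc)
import Data.Nat.Properties as ℕ
open import Data.List.Extrema ℕ.≤-totalOrder using (argmax)
open import Data.Product using (_,_; proj₁; proj₂; ∃)
open import Data.Vec.Functional using (Vector)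
open import Function using (_∘_)
open import Relation.Binary.Definitions using (DecidableEquality)
open import Relation.Binary.PropositionalEquality as ≡ using (_≡_; _≢_)
open import Relation.Nullary using (Dec; yes; no; ¬_; contradiction)
open import Relation.Nullary.Decidable using (map′; _×-dec_)
import Relation.Binary.Reasoning.Setoid as SetoidReasoning
import Algebra.Solver.Ring.NaturalCoefficients.Default as Solver

------------------------------------------------------------------------
-- The total ring of fractions of a commutative ring R.  When R is an
-- integral domain this is its field of fractions.

module Fractions {c ℓ} (R : CommutativeRing c ℓ) where

  open CommutativeRing R
  open Solver commutativeSemiring using (solve; _:=_; _:+_; _:*_)
  open RingProperties ring using (-‿distribˡ-*; x∙y⁻¹≈ε⇒x≈y; -‿distribʳ-*)
  open SetoidReasoning setoid

  Regular : Carrier → Set (c ⊔ ℓ)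
  Regular s = ∀ x → s * x ≈ 0# → x ≈ 0#

  cancel : ∀ {s} → Regular s → ∀ x y → s * x ≈ s * y → x ≈ y
  cancel {s} r x y sx≈sy = x∙y⁻¹≈ε⇒x≈y x y (r (x - y) (begin
    s * (x - y)        ≈⟨ distribˡ s x (- y) ⟩
    s * x + s * (- y)  ≈⟨ +-cong sx≈sy (sym (-‿distribʳ-* s y)) ⟩
    s * y - s * y      ≈⟨ -‿inverseʳ (s * y) ⟩
    0#                 ∎))

  regular-1 : Regular 1#
  regular-1 x 1x≈0 = trans (sym (*-identityˡ x)) 1x≈0

  regular-* : ∀ {s u} → Regular s → Regular u → Regular (s * u)
  regular-* {s} {u} rs ru x e = ru x (rs (u * x) (trans (sym (*-assoc s u x)) e))

  regular-factorˡ : ∀ {s u} → Regular (s * u) → Regular s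
  regular-factorˡ {s} {u} r x sx≈0 = r x (begin
    s * u * x    ≈⟨ solve 3 (λ s u x → (s :* u :* x) := (u :* (s :* x))) refl s u x ⟩
    u * (s * x)  ≈⟨ *-congˡ sx≈0 ⟩
    u * 0#       ≈⟨ zeroʳ u ⟩
    0#           ∎)

  regular-cong : ∀ {s u} → s ≈ u → Regular s → Regular u
  regular-cong s≈u r x ux≈0 = r x (trans (*-congʳ s≈u) ux≈0)

  infix 8 _/_[_]
  record Fraction : Set (c ⊔ ℓ) where
    constructor _/_[_]
    field
      num         : Carrier
      den         : Carrier
      den-regular : Regular den
  open Fraction public

  infix 4 _≃_
  record _≃_ (f g : Fraction) : Set ℓ where
    constructor *≡*
    field cross : num f * den g ≈ num g * den f
  open _≃_ public

  ι : Carrier → Fraction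
  ι a = a / 1# [ regular-1 ]

  ≃-refl : ∀ {f} → f ≃ f
  ≃-refl = *≡* refl

  ≃-sym : ∀ {f g} → f ≃ g → g ≃ f
  ≃-sym (*≡* e) = *≡* (sym e)

  ≃-trans : ∀ {f g h} → f ≃ g → g ≃ h → f ≃ h
  ≃-trans {a / b [ _ ]} {c / d [ rd ]} {e / f [ _ ]} (*≡* p) (*≡* q) = *≡* (cancel rd (a * f) (e * b) (begin
    d * (a * f)  ≈⟨ solve 3 (λ a d f → (d :* (a :* f)) := (a :* d :* f)) refl a d f ⟩
    a * d * f    ≈⟨ *-congʳ p ⟩
    c * b * f    ≈⟨ solve 3 (λ b c f → (c :* b :* f) := (c :* f :* b)) refl b c f ⟩
    c * f * b    ≈⟨ *-congʳ q ⟩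
    e * d * b    ≈⟨ solve 3 (λ b d e → (e :* d :* b) := (d :* (e :* b))) refl b d e ⟩
    d * (e * b)  ∎))

  infixl 6 _+ᶠ_
  infixl 7 _*ᶠ_

  -- Opaque only to help unification.
  opaque
    _+ᶠ_ _*ᶠ_ : Fraction → Fraction → Fraction
    f +ᶠ g = (num f * den g + num g * den f) / den f * den g [ regular-* (den-regular f) (den-regular g) ]
    f *ᶠ g = (num f * num g) / den f * den g [ regular-* (den-regular f) (den-regular g) ]

    -ᶠ_ : Fraction → Fraction
    -ᶠ f = (- num f) / den f [ den-regular f ]

    +ᶠ-cong : ∀ {f f′ g g′} → f ≃ f′ → g ≃ g′ → f +ᶠ g ≃ f′ +ᶠ g′
    +ᶠ-cong {a / b [ _ ]} {a′ / b′ [ _ ]} {c / d [ _ ]} {c′ / d′ [ _ ]} (*≡* p) (*≡* q) = *≡* (begin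
      (a * d + c * b) * (b′ * d′)
        ≈⟨ solve 6 (λ a b c d b′ d′ → ((a :* d :+ c :* b) :* (b′ :* d′)) := (a :* b′ :* (d :* d′) :+ c :* d′ :* (b :* b′))) refl a b c d b′ d′ ⟩
      a * b′ * (d * d′) + c * d′ * (b * b′)
        ≈⟨ +-cong (*-congʳ p) (*-congʳ q) ⟩
      a′ * b * (d * d′) + c′ * d * (b * b′)
        ≈⟨ solve 6 (λ a′ b c′ d b′ d′ → (a′ :* b :* (d :* d′) :+ c′ :* d :* (b :* b′)) := ((a′ :* d′ :+ c′ :* b′) :* (b :* d))) refl a′ b c′ d b′ d′ ⟩
      (a′ * d′ + c′ * b′) * (b * d) ∎)

    *ᶠ-cong : ∀ {f f′ g g′} → f ≃ f′ → g ≃ g′ → f *ᶠ g ≃ f′ *ᶠ g′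
    *ᶠ-cong {a / b [ _ ]} {a′ / b′ [ _ ]} {c / d [ _ ]} {c′ / d′ [ _ ]} (*≡* p) (*≡* q) = *≡* (begin
      a * c * (b′ * d′)    ≈⟨ solve 4 (λ a c b′ d′ → (a :* c :* (b′ :* d′)) := (a :* b′ :* (c :* d′))) refl a c b′ d′ ⟩
      a * b′ * (c * d′)    ≈⟨ *-cong p q ⟩
      a′ * b * (c′ * d)    ≈⟨ solve 4 (λ a b c d → (a :* b :* (c :* d)) := (a :* c :* (b :* d))) refl a′ b c′ d ⟩
      a′ * c′ * (b * d)    ∎)

    -ᶠ-cong : ∀ {f g} → f ≃ g → -ᶠ f ≃ -ᶠ g
    -ᶠ-cong {a / b [ _ ]} {c / d [ _ ]} (*≡* p) =
      *≡* (trans (sym (-‿distribˡ-* a d)) (trans (-‿cong p) (-‿distribˡ-* c b)))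

    +ᶠ-assoc : ∀ f g h → (f +ᶠ g) +ᶠ h ≃ f +ᶠ (g +ᶠ h)
    +ᶠ-assoc (a / b [ _ ]) (c / d [ _ ]) (e / f [ _ ]) = *≡* (solve 6 (λ a b c d e f →
      (((a :* d :+ c :* b) :* f :+ e :* (b :* d)) :* (b :* (d :* f))) := ((a :* (d :* f) :+ (c :* f :+ e :* d) :* b) :* (b :* d :* f))) refl a b c d e f)

    +ᶠ-comm : ∀ f g → f +ᶠ g ≃ g +ᶠ f
    +ᶠ-comm (a / b [ _ ]) (c / d [ _ ]) = *≡* (solve 4 (λ a b c d →
      ((a :* d :+ c :* b) :* (d :* b)) := ((c :* b :+ a :* d) :* (b :* d))) refl a b c d)

    +ᶠ-identityˡ : ∀ f → ι 0# +ᶠ f ≃ f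
    +ᶠ-identityˡ (a / b [ _ ]) = *≡* (begin
      (0# * b + a * 1#) * b  ≈⟨ *-congʳ (trans (+-congʳ (zeroˡ b)) (+-identityˡ (a * 1#))) ⟩
      a * 1# * b             ≈⟨ *-assoc a 1# b ⟩
      a * (1# * b)           ∎)

    -ᶠ-inverseˡ : ∀ f → -ᶠ f +ᶠ f ≃ ι 0#
    -ᶠ-inverseˡ (a / b [ _ ]) = *≡* (begin
      (- a * b + a * b) * 1#  ≈⟨ *-identityʳ _ ⟩
      - a * b + a * b         ≈⟨ distribʳ b (- a) a ⟨
      (- a + a) * b           ≈⟨ *-congʳ (-‿inverseˡ a) ⟩
      0# * b                  ≈⟨ zeroˡ b ⟩
      0#                      ≈⟨ zeroˡ (b * b) ⟨
      0# * (b * b)            ∎)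

    *ᶠ-assoc : ∀ f g h → (f *ᶠ g) *ᶠ h ≃ f *ᶠ (g *ᶠ h)
    *ᶠ-assoc (a / b [ _ ]) (c / d [ _ ]) (e / f [ _ ]) =
      *≡* (*-cong (*-assoc a c e) (sym (*-assoc b d f)))

    *ᶠ-comm : ∀ f g → f *ᶠ g ≃ g *ᶠ f
    *ᶠ-comm (a / b [ _ ]) (c / d [ _ ]) = *≡* (*-cong (*-comm a c) (*-comm d b))

    *ᶠ-identityˡ : ∀ f → ι 1# *ᶠ f ≃ f
    *ᶠ-identityˡ (a / b [ _ ]) = *≡* (begin
      1# * a * b    ≈⟨ *-congʳ (*-comm 1# a) ⟩
      a * 1# * b    ≈⟨ *-assoc a 1# b ⟩
      a * (1# * b)  ∎)

    *ᶠ-distribˡ : ∀ f g h → f *ᶠ (g +ᶠ h) ≃ f *ᶠ g +ᶠ f *ᶠ h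
    *ᶠ-distribˡ (a / b [ _ ]) (c / d [ _ ]) (e / f [ _ ]) = *≡* (solve 6 (λ a b c d e f →
      ((a :* (c :* f :+ e :* d)) :* (b :* d :* (b :* f))) := ((a :* c :* (b :* f) :+ a :* e :* (b :* d)) :* (b :* (d :* f)))) refl a b c d e f)

  fractionRing : CommutativeRing (c ⊔ ℓ) ℓ
  fractionRing = record
    { Carrier = Fraction ; _≈_ = _≃_ ; _+_ = _+ᶠ_ ; _*_ = _*ᶠ_ ; -_ = -ᶠ_ ; 0# = ι 0# ; 1# = ι 1#
    ; isCommutativeRing = record
      { isRing = record
        { +-isAbelianGroup = record
          { isGroup = record
            { isMonoid = record
              { isSemigroup = record
                { isMagma = record
                  { isEquivalence = record { refl = ≃-refl ; sym = ≃-sym ; trans = ≃-trans }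
                  ; ∙-cong = +ᶠ-cong }
                ; assoc = +ᶠ-assoc }
              ; identity = +ᶠ-identityˡ , λ f → ≃-trans (+ᶠ-comm f (ι 0#)) (+ᶠ-identityˡ f) }
            ; inverse = -ᶠ-inverseˡ , λ f → ≃-trans (+ᶠ-comm f (-ᶠ f)) (-ᶠ-inverseˡ f)
            ; ⁻¹-cong = -ᶠ-cong }
          ; comm = +ᶠ-comm }
        ; *-cong = *ᶠ-cong
        ; *-assoc = *ᶠ-assoc
        ; *-identity = *ᶠ-identityˡ , λ f → ≃-trans (*ᶠ-comm f (ι 1#)) (*ᶠ-identityˡ f)
        ; distrib = *ᶠ-distribˡ , λ f g h →
            ≃-trans (*ᶠ-comm (g +ᶠ h) f)
            (≃-trans (*ᶠ-distribˡ f g h) (+ᶠ-cong (*ᶠ-comm f g) (*ᶠ-comm f h))) }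
      ; *-comm = *ᶠ-comm } }

  opaque
    unfolding _+ᶠ_

    ι-+ : ∀ a b → ι (a + b) ≃ ι a +ᶠ ι b
    ι-+ a b = *≡* (begin
      (a + b) * (1# * 1#)      ≈⟨ *-congˡ (*-identityˡ 1#) ⟩
      (a + b) * 1#             ≈⟨ *-congʳ (+-cong (*-identityʳ a) (*-identityʳ b)) ⟨
      (a * 1# + b * 1#) * 1#   ∎)

    ι-* : ∀ a b → ι (a * b) ≃ ι a *ᶠ ι b
    ι-* a b = *≡* (*-congˡ (*-identityˡ 1#))

    ι-- : ∀ a → ι (- a) ≃ -ᶠ ι a
    ι-- a = ≃-refl

  ι-isRingHomomorphism : IsRingHomomorphism rawRing (CommutativeRing.rawRing fractionRing) ι
  ι-isRingHomomorphism = record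
    { isSemiringHomomorphism = record
      { isNearSemiringHomomorphism = record
        { +-isMonoidHomomorphism = record
          { isMagmaHomomorphism = record
            { isRelHomomorphism = record { cong = λ e → *≡* (*-congʳ e) } ; homo = ι-+ }
          ; ε-homo = ≃-refl }
        ; *-homo = ι-* }
      ; 1#-homo = ≃-refl }
    ; -‿homo = ι-- }

  -- f is invertible in the total ring of fractions; over a domain, f ≠ 0.
  NonZero : Fraction → Set (c ⊔ ℓ)
  NonZero f = Regular (num f)

  nonZero-cong : ∀ {f g} → f ≃ g → NonZero f → NonZero g
  nonZero-cong {f} {g} (*≡* e) r =
    regular-factorˡ {u = den f} (regular-cong e (regular-* r (den-regular g)))

  infixl 7 _÷_[_]
  _÷_[_] : Fraction → (g : Fraction) → NonZero g → Fraction
  f ÷ g [ nz ] = f *ᶠ (den g / num g [ nz ])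

  opaque
    unfolding _*ᶠ_

    ÷-cong-cross : ∀ {f g f′ g′} (nz : NonZero g) (nz′ : NonZero g′) →
                   f *ᶠ g′ ≃ f′ *ᶠ g → f ÷ g [ nz ] ≃ f′ ÷ g′ [ nz′ ]
    ÷-cong-cross {a / b [ _ ]} {c / d [ _ ]} {a′ / b′ [ _ ]} {c′ / d′ [ _ ]} _ _ (*≡* e) = *≡* (begin
      a * d * (b′ * c′)    ≈⟨ solve 4 (λ a d b′ c′ → (a :* d :* (b′ :* c′)) := (a :* c′ :* (b′ :* d))) refl a d b′ c′ ⟩
      a * c′ * (b′ * d)    ≈⟨ e ⟩
      a′ * c * (b * d′)    ≈⟨ solve 4 (λ a d b′ c′ → (a :* c′ :* (b′ :* d)) := (a :* d :* (b′ :* c′))) refl a′ d′ b c ⟩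
      a′ * d′ * (b * c)    ∎)

------------------------------------------------------------------------
-- Polynomials over K in a set V of variables: the free commutative
-- K-algebra on V, as terms modulo the least K-algebra congruence.

module Polynomials {c ℓ} (K : CommutativeRing c ℓ) where

  private module K = CommutativeRing K

  infixl 6 _⊕_
  infixl 7 _⊗_
  infix  8 ⊖_
  infix  4 _≋_

  data Poly (V : Set) : Set c where
    con : K.Carrier → Poly V
    var : V → Poly V
    _⊕_ : Poly V → Poly V → Poly V
    _⊗_ : Poly V → Poly V → Poly V
    ⊖_  : Poly V → Poly V

  data _≋_ {V : Set} : Poly V → Poly V → Set (c ⊔ ℓ) where
    ≋-refl      : ∀ {p} → p ≋ p
    ≋-sym       : ∀ {p q} → p ≋ q → q ≋ p
    ≋-trans     : ∀ {p q r} → p ≋ q → q ≋ r → p ≋ r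
    ⊕-cong      : ∀ {p p′ q q′} → p ≋ p′ → q ≋ q′ → p ⊕ q ≋ p′ ⊕ q′
    ⊗-cong      : ∀ {p p′ q q′} → p ≋ p′ → q ≋ q′ → p ⊗ q ≋ p′ ⊗ q′
    ⊖-cong      : ∀ {p p′} → p ≋ p′ → ⊖ p ≋ ⊖ p′
    ⊕-assoc     : ∀ p q r → (p ⊕ q) ⊕ r ≋ p ⊕ (q ⊕ r)
    ⊕-comm      : ∀ p q → p ⊕ q ≋ q ⊕ p
    ⊕-identityˡ : ∀ p → con K.0# ⊕ p ≋ p
    ⊖-inverseˡ  : ∀ p → ⊖ p ⊕ p ≋ con K.0#
    ⊗-assoc     : ∀ p q r → (p ⊗ q) ⊗ r ≋ p ⊗ (q ⊗ r)
    ⊗-comm      : ∀ p q → p ⊗ q ≋ q ⊗ p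
    ⊗-identityˡ : ∀ p → con K.1# ⊗ p ≋ p
    distribˡ    : ∀ p q r → p ⊗ (q ⊕ r) ≋ p ⊗ q ⊕ p ⊗ r
    con-cong    : ∀ {a b} → a K.≈ b → con a ≋ con b
    con-+       : ∀ a b → con (a K.+ b) ≋ con a ⊕ con b
    con-*       : ∀ a b → con (a K.* b) ≋ con a ⊗ con b
    con--       : ∀ a → con (K.- a) ≋ ⊖ con a

  polyRing : Set → CommutativeRing c (c ⊔ ℓ)
  polyRing V = record
    { Carrier = Poly V ; _≈_ = _≋_ ; _+_ = _⊕_ ; _*_ = _⊗_ ; -_ = ⊖_ ; 0# = con K.0# ; 1# = con K.1#
    ; isCommutativeRing = record
      { isRing = record
        { +-isAbelianGroup = record
          { isGroup = record
            { isMonoid = record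
              { isSemigroup = record
                { isMagma = record
                  { isEquivalence = record { refl = ≋-refl ; sym = ≋-sym ; trans = ≋-trans }
                  ; ∙-cong = ⊕-cong }
                ; assoc = ⊕-assoc }
              ; identity = ⊕-identityˡ , λ p → ≋-trans (⊕-comm p _) (⊕-identityˡ p) }
            ; inverse = ⊖-inverseˡ , λ p → ≋-trans (⊕-comm p _) (⊖-inverseˡ p)
            ; ⁻¹-cong = ⊖-cong }
          ; comm = ⊕-comm }
        ; *-cong = ⊗-cong
        ; *-assoc = ⊗-assoc
        ; *-identity = ⊗-identityˡ , λ p → ≋-trans (⊗-comm p _) (⊗-identityˡ p)
        ; distrib = distribˡ , λ p q r →
            ≋-trans (⊗-comm (q ⊕ r) p)
            (≋-trans (distribˡ p q r) (⊕-cong (⊗-comm p q) (⊗-comm p r))) }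
      ; *-comm = ⊗-comm } }

  con-isRingHomomorphism : ∀ {V} → IsRingHomomorphism K.rawRing (CommutativeRing.rawRing (polyRing V)) con
  con-isRingHomomorphism = record
    { isSemiringHomomorphism = record
      { isNearSemiringHomomorphism = record
        { +-isMonoidHomomorphism = record
          { isMagmaHomomorphism = record
            { isRelHomomorphism = record { cong = con-cong } ; homo = con-+ }
          ; ε-homo = ≋-refl }
        ; *-homo = con-* }
      ; 1#-homo = ≋-refl }
    ; -‿homo = con-- }

  module Evaluation {a b} (A : CommutativeRing a b) {φ : K.Carrier → CommutativeRing.Carrier A}
    (φ-hom : IsRingHomomorphism K.rawRing (CommutativeRing.rawRing A) φ)
    {V : Set} (ρ : V → CommutativeRing.Carrier A) where

    private
      module A = CommutativeRing A
      module φ = IsRingHomomorphism φ-hom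

    eval : Poly V → A.Carrier
    eval (con k) = φ k
    eval (var v) = ρ v
    eval (p ⊕ q) = eval p A.+ eval q
    eval (p ⊗ q) = eval p A.* eval q
    eval (⊖ p)   = A.- eval p

    eval-cong : ∀ {p q} → p ≋ q → eval p A.≈ eval q
    eval-cong ≋-refl            = A.refl
    eval-cong (≋-sym e)         = A.sym (eval-cong e)
    eval-cong (≋-trans e f)     = A.trans (eval-cong e) (eval-cong f)
    eval-cong (⊕-cong e f)      = A.+-cong (eval-cong e) (eval-cong f)
    eval-cong (⊗-cong e f)      = A.*-cong (eval-cong e) (eval-cong f)
    eval-cong (⊖-cong e)        = A.-‿cong (eval-cong e)
    eval-cong (⊕-assoc p q r)   = A.+-assoc _ _ _
    eval-cong (⊕-comm p q)      = A.+-comm _ _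
    eval-cong (⊕-identityˡ p)   = A.trans (A.+-congʳ φ.0#-homo) (A.+-identityˡ _)
    eval-cong (⊖-inverseˡ p)    = A.trans (A.-‿inverseˡ _) (A.sym φ.0#-homo)
    eval-cong (⊗-assoc p q r)   = A.*-assoc _ _ _
    eval-cong (⊗-comm p q)      = A.*-comm _ _
    eval-cong (⊗-identityˡ p)   = A.trans (A.*-congʳ φ.1#-homo) (A.*-identityˡ _)
    eval-cong (distribˡ p q r)  = A.distribˡ _ _ _
    eval-cong (con-cong e)      = φ.⟦⟧-cong e
    eval-cong (con-+ a b)       = φ.+-homo a b
    eval-cong (con-* a b)       = φ.*-homo a b
    eval-cong (con-- a)         = φ.-‿homo a

  substitute : ∀ {V W : Set} → (V → Poly W) → Poly V → Poly W
  substitute = Evaluation.eval (polyRing _) con-isRingHomomorphism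

  substitute-cong : ∀ {V W : Set} (ρ : V → Poly W) {p q} → p ≋ q → substitute ρ p ≋ substitute ρ q
  substitute-cong = Evaluation.eval-cong (polyRing _) con-isRingHomomorphism

  -- With σ the substitution x_v ↦ a, ∂ p is the divided difference
  -- (p - σ p) / (x_v - a); it is used only to prove elements regular.
  module DividedDifference {V : Set} (_≟_ : DecidableEquality V) (v : V) (a : Poly V) where

    open CommutativeRing (polyRing V) hiding (distribˡ)
    open Fractions (polyRing V) using (Regular)
    open Solver commutativeSemiring using (solve; _:=_; _:+_; _:*_)
    open RingProperties ring using (-‿distribˡ-*; -‿distribʳ-*; -0#≈0#; -‿+-comm; x∙y⁻¹≈ε⇒x≈y)
    open Exp semiring using (_^_)
    open SetoidReasoning setoid

    point : V → Poly V
    point u with u ≟ v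
    ... | yes _ = a
    ... | no  _ = var u

    σ : Poly V → Poly V
    σ = substitute point

    ∂ : Poly V → Poly V
    ∂ (con k) = 0#
    ∂ (var u) with u ≟ v
    ... | yes _ = 1#
    ... | no  _ = 0#
    ∂ (p ⊕ q) = ∂ p ⊕ ∂ q
    ∂ (p ⊗ q) = ∂ p ⊗ q ⊕ σ p ⊗ ∂ q
    ∂ (⊖ p)   = ⊖ ∂ p

    private
      z : Poly V
      z = var v - a

    taylor : ∀ p → p ≋ σ p ⊕ z ⊗ ∂ p
    taylor (con k) = sym (trans (+-congˡ (zeroʳ z)) (+-identityʳ (con k)))
    taylor (var u) with u ≟ v
    ... | yes ≡.refl = sym (begin
            a ⊕ (var u - a) ⊗ 1#  ≈⟨ +-congˡ (*-identityʳ z) ⟩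
            a ⊕ (var u - a)       ≈⟨ +-comm a z ⟩
            var u - a ⊕ a         ≈⟨ +-assoc (var u) (⊖ a) a ⟩
            var u ⊕ (⊖ a ⊕ a)     ≈⟨ +-congˡ (-‿inverseˡ a) ⟩
            var u ⊕ 0#            ≈⟨ +-identityʳ (var u) ⟩
            var u                 ∎)
    ... | no  _      = sym (trans (+-congˡ (zeroʳ z)) (+-identityʳ (var u)))
    taylor (p ⊕ q) = begin
      p ⊕ q                                ≈⟨ +-cong (taylor p) (taylor q) ⟩
      (σ p ⊕ z ⊗ ∂ p) ⊕ (σ q ⊕ z ⊗ ∂ q)    ≈⟨ solve 5 (λ a b c d z → ((a :+ z :* b) :+ (c :+ z :* d)) := ((a :+ c) :+ z :* (b :+ d))) refl (σ p) (∂ p) (σ q) (∂ q) z ⟩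
      (σ p ⊕ σ q) ⊕ z ⊗ (∂ p ⊕ ∂ q)        ∎
    taylor (p ⊗ q) = begin
      p ⊗ q                                   ≈⟨ *-congʳ (taylor p) ⟩
      (σ p ⊕ z ⊗ ∂ p) ⊗ q                     ≈⟨ solve 4 (λ a b q z → ((a :+ z :* b) :* q) := (a :* q :+ z :* (b :* q))) refl (σ p) (∂ p) q z ⟩
      σ p ⊗ q ⊕ z ⊗ (∂ p ⊗ q)                 ≈⟨ +-congʳ (*-congˡ (taylor q)) ⟩
      σ p ⊗ (σ q ⊕ z ⊗ ∂ q) ⊕ z ⊗ (∂ p ⊗ q)   ≈⟨ solve 5 (λ a b c d z → (a :* (c :+ z :* d) :+ z :* b) := (a :* c :+ z :* (b :+ a :* d))) refl (σ p) (∂ p ⊗ q) (σ q) (∂ q) z ⟩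
      σ p ⊗ σ q ⊕ z ⊗ (∂ p ⊗ q ⊕ σ p ⊗ ∂ q)   ∎
    taylor (⊖ p) = begin
      ⊖ p                     ≈⟨ -‿cong (taylor p) ⟩
      ⊖ (σ p ⊕ z ⊗ ∂ p)       ≈⟨ -‿+-comm (σ p) (z ⊗ ∂ p) ⟨
      ⊖ σ p ⊕ ⊖ (z ⊗ ∂ p)     ≈⟨ +-congˡ (-‿distribʳ-* z (∂ p)) ⟩
      ⊖ σ p ⊕ z ⊗ (⊖ ∂ p)     ∎

    ∂-cong : ∀ {p q} → p ≋ q → ∂ p ≋ ∂ q
    ∂-cong ≋-refl          = refl
    ∂-cong (≋-sym e)       = sym (∂-cong e)
    ∂-cong (≋-trans e f)   = trans (∂-cong e) (∂-cong f)
    ∂-cong (⊕-cong e f)    = +-cong (∂-cong e) (∂-cong f)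
    ∂-cong (⊗-cong e f)    = +-cong (*-cong (∂-cong e) f) (*-cong (substitute-cong point e) (∂-cong f))
    ∂-cong (⊖-cong e)      = -‿cong (∂-cong e)
    ∂-cong (⊕-assoc p q r) = +-assoc _ _ _
    ∂-cong (⊕-comm p q)    = +-comm _ _
    ∂-cong (⊕-identityˡ p) = +-identityˡ _
    ∂-cong (⊖-inverseˡ p)  = -‿inverseˡ _
    ∂-cong (⊗-assoc p q r) = solve 7 (λ p′ p₀ q q′ q₀ r r′ → ((p′ :* q :+ p₀ :* q′) :* r :+ p₀ :* q₀ :* r′) := (p′ :* (q :* r) :+ p₀ :* (q′ :* r :+ q₀ :* r′))) refl (∂ p) (σ p) q (∂ q) (σ q) r (∂ r)
    ∂-cong (⊗-comm p q)    = begin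
      ∂ p ⊗ q ⊕ σ p ⊗ ∂ q                  ≈⟨ +-congʳ (*-congˡ (taylor q)) ⟩
      ∂ p ⊗ (σ q ⊕ z ⊗ ∂ q) ⊕ σ p ⊗ ∂ q    ≈⟨ solve 5 (λ a b c d z → (b :* (c :+ z :* d) :+ a :* d) := (d :* (a :+ z :* b) :+ c :* b)) refl (σ p) (∂ p) (σ q) (∂ q) z ⟩
      ∂ q ⊗ (σ p ⊕ z ⊗ ∂ p) ⊕ σ q ⊗ ∂ p    ≈⟨ +-congʳ (*-congˡ (taylor p)) ⟨
      ∂ q ⊗ p ⊕ σ q ⊗ ∂ p                  ∎
    ∂-cong (⊗-identityˡ p) = trans (+-cong (zeroˡ p) (*-identityˡ (∂ p))) (+-identityˡ (∂ p))
    ∂-cong (distribˡ p q r) = solve 6 (λ p′ p₀ q q′ r r′ → (p′ :* (q :+ r) :+ p₀ :* (q′ :+ r′)) := ((p′ :* q :+ p₀ :* q′) :+ (p′ :* r :+ p₀ :* r′))) refl (∂ p) (σ p) q (∂ q) r (∂ r)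
    ∂-cong (con-cong e)    = refl
    ∂-cong (con-+ a b)     = sym (+-identityˡ 0#)
    ∂-cong (con-* a b)     = sym (trans (+-cong (zeroˡ _) (zeroʳ _)) (+-identityˡ 0#))
    ∂-cong (con-- a)       = sym -0#≈0#

    private
      ∂-var : ∂ (var v) ≡ 1#
      ∂-var with v ≟ v
      ... | yes _  = ≡.refl
      ... | no v≢v = contradiction ≡.refl v≢v

      σ-var : σ (var v) ≡ a
      σ-var with v ≟ v
      ... | yes _  = ≡.refl
      ... | no v≢v = contradiction ≡.refl v≢v

    module FreeOf-v (∂a≋0 : ∂ a ≋ 0#) (σa≋a : σ a ≋ a) where

      ∂-z* : ∀ p → ∂ (z ⊗ p) ≋ p
      ∂-z* p = begin
        (∂ (var v) - ∂ a) ⊗ p ⊕ (σ (var v) - σ a) ⊗ ∂ p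
          ≈⟨ +-cong (*-congʳ (+-cong (reflexive ∂-var) (-‿cong ∂a≋0)))
                    (*-congʳ (+-cong (reflexive σ-var) (-‿cong σa≋a))) ⟩
        (1# - 0#) ⊗ p ⊕ (a - a) ⊗ ∂ p
          ≈⟨ +-cong (*-congʳ (trans (+-congˡ -0#≈0#) (+-identityʳ 1#))) (*-congʳ (-‿inverseʳ a)) ⟩
        1# ⊗ p ⊕ 0# ⊗ ∂ p
          ≈⟨ +-cong (*-identityˡ p) (zeroˡ (∂ p)) ⟩
        p ⊕ 0#
          ≈⟨ +-identityʳ p ⟩
        p ∎

      z-regular : Regular z
      z-regular p zp≋0 = trans (sym (∂-z* p)) (∂-cong zp≋0)

      ∂σ≋0 : ∀ p → ∂ (σ p) ≋ 0#
      σσ≋σ : ∀ p → σ (σ p) ≋ σ p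

      σσ≋σ (con k) = refl
      σσ≋σ (var u) with u ≟ v
      ... | yes _  = σa≋a
      ... | no u≢v with u ≟ v
      ...   | yes u≡v = contradiction u≡v u≢v
      ...   | no _    = refl
      σσ≋σ (p ⊕ q) = +-cong (σσ≋σ p) (σσ≋σ q)
      σσ≋σ (p ⊗ q) = *-cong (σσ≋σ p) (σσ≋σ q)
      σσ≋σ (⊖ p)   = -‿cong (σσ≋σ p)

      ∂σ≋0 (con k) = refl
      ∂σ≋0 (var u) with u ≟ v
      ... | yes _  = ∂a≋0
      ... | no u≢v with u ≟ v
      ...   | yes u≡v = contradiction u≡v u≢v
      ...   | no _    = refl
      ∂σ≋0 (p ⊕ q) = trans (+-cong (∂σ≋0 p) (∂σ≋0 q)) (+-identityˡ 0#)
      ∂σ≋0 (p ⊗ q) = begin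
        ∂ (σ p) ⊗ σ q ⊕ σ (σ p) ⊗ ∂ (σ q)  ≈⟨ +-cong (*-congʳ (∂σ≋0 p)) (*-congˡ (∂σ≋0 q)) ⟩
        0# ⊗ σ q ⊕ σ (σ p) ⊗ 0#            ≈⟨ +-cong (zeroˡ _) (zeroʳ _) ⟩
        0# ⊕ 0#                            ≈⟨ +-identityˡ 0# ⟩
        0#                                 ∎
      ∂σ≋0 (⊖ p)   = trans (-‿cong (∂σ≋0 p)) -0#≈0#

      ∂^ : ℕ → Poly V → Poly V
      ∂^ zero    p = p
      ∂^ (suc k) p = ∂^ k (∂ p)

      ∂^-cong : ∀ k {p q} → p ≋ q → ∂^ k p ≋ ∂^ k q
      ∂^-cong zero    e = e
      ∂^-cong (suc k) e = ∂^-cong k (∂-cong e)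

      ∂^-0 : ∀ k → ∂^ k 0# ≋ 0#
      ∂^-0 zero    = refl
      ∂^-0 (suc k) = ∂^-0 k

      ∂^-⊕ : ∀ k p q → ∂^ k (p ⊕ q) ≋ ∂^ k p ⊕ ∂^ k q
      ∂^-⊕ zero    p q = refl
      ∂^-⊕ (suc k) p q = ∂^-⊕ k (∂ p) (∂ q)

      ∂^-⊖ : ∀ k p → ∂^ k (⊖ p) ≋ ⊖ ∂^ k p
      ∂^-⊖ zero    p = refl
      ∂^-⊖ (suc k) p = ∂^-⊖ k (∂ p)

      ∂^-+ : ∀ j k p → ∂^ (j ℕ.+ k) p ≡ ∂^ k (∂^ j p)
      ∂^-+ zero    k p = ≡.refl
      ∂^-+ (suc j) k p = ∂^-+ j k (∂ p)

      ∂^-mono : ∀ {j k} p → j ℕ.≤ k → ∂^ j p ≋ 0# → ∂^ k p ≋ 0#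
      ∂^-mono {j} {k} p j≤k e = begin
        ∂^ k p                  ≡⟨ ≡.cong (λ i → ∂^ i p) (ℕ.m+[n∸m]≡n j≤k) ⟨
        ∂^ (j ℕ.+ (k ℕ.∸ j)) p  ≡⟨ ∂^-+ j (k ℕ.∸ j) p ⟩
        ∂^ (k ℕ.∸ j) (∂^ j p)   ≈⟨ ∂^-cong (k ℕ.∸ j) e ⟩
        ∂^ (k ℕ.∸ j) 0#         ≈⟨ ∂^-0 (k ℕ.∸ j) ⟩
        0#                      ∎

      ∂^-const* : ∀ k p q → ∂ p ≋ 0# → σ p ≋ p → ∂^ k (p ⊗ q) ≋ p ⊗ ∂^ k q
      ∂^-const* zero    p q _   _   = refl
      ∂^-const* (suc k) p q ∂p≋0 σp≋p = begin
        ∂^ k (∂ p ⊗ q ⊕ σ p ⊗ ∂ q)  ≈⟨ ∂^-cong k (+-cong (*-congʳ ∂p≋0) (*-congʳ σp≋p)) ⟩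
        ∂^ k (0# ⊗ q ⊕ p ⊗ ∂ q)     ≈⟨ ∂^-cong k (trans (+-congʳ (zeroˡ q)) (+-identityˡ _)) ⟩
        ∂^ k (p ⊗ ∂ q)              ≈⟨ ∂^-const* k p (∂ q) ∂p≋0 σp≋p ⟩
        p ⊗ ∂^ k (∂ q)              ∎

      nilpotent-⊗ : ∀ j k p q → ∂^ j p ≋ 0# → ∂^ k q ≋ 0# → ∂^ (j ℕ.+ k) (p ⊗ q) ≋ 0#
      nilpotent-⊗ zero    k p q ep eq = begin
        ∂^ k (p ⊗ q)   ≈⟨ ∂^-cong k (trans (*-congʳ ep) (zeroˡ q)) ⟩
        ∂^ k 0#        ≈⟨ ∂^-0 k ⟩
        0#             ∎
      nilpotent-⊗ (suc j) k p q ep eq = begin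
        ∂^ (j ℕ.+ k) (∂ p ⊗ q ⊕ σ p ⊗ ∂ q)
          ≈⟨ ∂^-⊕ (j ℕ.+ k) (∂ p ⊗ q) (σ p ⊗ ∂ q) ⟩
        ∂^ (j ℕ.+ k) (∂ p ⊗ q) ⊕ ∂^ (j ℕ.+ k) (σ p ⊗ ∂ q)
          ≈⟨ +-cong (nilpotent-⊗ j k (∂ p) q ep eq) (∂^-const* (j ℕ.+ k) (σ p) (∂ q) (∂σ≋0 p) (σσ≋σ p)) ⟩
        0# ⊕ σ p ⊗ ∂^ (suc (j ℕ.+ k)) q
          ≈⟨ +-identityˡ _ ⟩
        σ p ⊗ ∂^ (suc (j ℕ.+ k)) q
          ≈⟨ *-congˡ (∂^-mono q (ℕ.m≤n+m k (suc j)) eq) ⟩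
        σ p ⊗ 0#
          ≈⟨ zeroʳ (σ p) ⟩
        0# ∎

      nilpotent : ∀ p → ∃ λ k → ∂^ k p ≋ 0#
      nilpotent (con x) = 1 , refl
      nilpotent (var u) = 2 , ∂∂var
        where
        ∂∂var : ∂ (∂ (var u)) ≋ 0#
        ∂∂var with u ≟ v
        ... | yes _ = refl
        ... | no  _ = refl
      nilpotent (p ⊕ q) with nilpotent p | nilpotent q
      ... | j , ep | k , eq = j ℕ.+ k , (begin
        ∂^ (j ℕ.+ k) (p ⊕ q)                 ≈⟨ ∂^-⊕ (j ℕ.+ k) p q ⟩
        ∂^ (j ℕ.+ k) p ⊕ ∂^ (j ℕ.+ k) q      ≈⟨ +-cong (∂^-mono p (ℕ.m≤m+n j k) ep) (∂^-mono q (ℕ.m≤n+m k j) eq) ⟩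
        0# ⊕ 0#                              ≈⟨ +-identityˡ 0# ⟩
        0#                                   ∎)
      nilpotent (p ⊗ q) with nilpotent p | nilpotent q
      ... | j , ep | k , eq = j ℕ.+ k , nilpotent-⊗ j k p q ep eq
      nilpotent (⊖ p) with nilpotent p
      ... | j , ep = j , trans (∂^-⊖ j p) (trans (-‿cong ep) -0#≈0#)

      ∂^-z^* : ∀ m p → ∂^ m (z ^ m ⊗ p) ≋ p
      ∂^-z^* zero    p = *-identityˡ p
      ∂^-z^* (suc m) p = begin
        ∂^ m (∂ (z ⊗ z ^ m ⊗ p))    ≈⟨ ∂^-cong m (∂-cong (*-assoc z (z ^ m) p)) ⟩
        ∂^ m (∂ (z ⊗ (z ^ m ⊗ p)))  ≈⟨ ∂^-cong m (∂-z* (z ^ m ⊗ p)) ⟩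
        ∂^ m (z ^ m ⊗ p)            ≈⟨ ∂^-z^* m p ⟩
        p                           ∎

      -- If (1 - z^m) p = 0 then p = ∂^m (z^m p) = ∂^m p, and ∂ is locally nilpotent.
      1-z^m-regular : ∀ m → 1 ℕ.≤ m → Regular (1# - z ^ m)
      1-z^m-regular m 1≤m p e = begin
        p                  ≈⟨ fixed k ⟨
        ∂^ (k ℕ.* m) p     ≈⟨ ∂^-mono p (ℕ.m≤m*n k m {{ℕ.>-nonZero 1≤m}}) (proj₂ (nilpotent p)) ⟩
        0#                 ∎
        where
        k = proj₁ (nilpotent p)

        p≋z^mp : p ≋ z ^ m ⊗ p
        p≋z^mp = x∙y⁻¹≈ε⇒x≈y p (z ^ m ⊗ p) (begin
          p - z ^ m ⊗ p              ≈⟨ +-cong (sym (*-identityˡ p)) (-‿distribˡ-* (z ^ m) p) ⟩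
          1# ⊗ p ⊕ (⊖ z ^ m) ⊗ p     ≈⟨ distribʳ p 1# (⊖ z ^ m) ⟨
          (1# - z ^ m) ⊗ p           ≈⟨ e ⟩
          0#                         ∎)

        fixed : ∀ k → ∂^ (k ℕ.* m) p ≋ p
        fixed zero    = refl
        fixed (suc k) = begin
          ∂^ (m ℕ.+ k ℕ.* m) p        ≡⟨ ∂^-+ m (k ℕ.* m) p ⟩
          ∂^ (k ℕ.* m) (∂^ m p)       ≈⟨ ∂^-cong (k ℕ.* m) (trans (∂^-cong m p≋z^mp) (∂^-z^* m p)) ⟩
          ∂^ (k ℕ.* m) p              ≈⟨ fixed k ⟩
          p                           ∎

------------------------------------------------------------------------
-- Each permutation occurs in S n exactly once up to pointwise equality:
-- S-complete and S-unique.

S : ∀ n → List (Permutation′ n)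
S zero    = Perm.id ∷ []
S (suc n) = concatMap (λ j → map (Perm.insert zero j) (S n)) (allFin (suc n))

S-complete : ∀ {n} (π : Permutation′ n) → Any (π Perm.≈_) (S n)
S-complete {zero}  π = here λ ()
S-complete {suc n} π =
  Any.concat⁺ (Any.map⁺ (Any.map (λ { ≡.refl → Any.map⁺ (Any.map ext (S-complete (Perm.remove zero π))) })
    (Mem.∈-allFin (π ⟨$⟩ʳ zero))))
  where
  ext : ∀ {ρ} → Perm.remove zero π Perm.≈ ρ → π Perm.≈ Perm.insert zero (π ⟨$⟩ʳ zero) ρ
  ext         e zero    = ≡.refl
  ext {ρ = ρ} e (suc k) = ≡.trans (≡.sym (Perm.insert-remove zero π (suc k)))
    (≡.cong (Fin.punchIn (π ⟨$⟩ʳ zero)) (e k))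

S-unique : ∀ n → AllPairs (λ π ρ → ¬ π Perm.≈ ρ) (S n)
S-unique zero    = [] ∷ []
S-unique (suc n) = AllPairs.concat⁺
  (All.map⁺ (All.universal (λ j → AllPairs.map⁺ (AllPairs.map (λ ne e → ne λ k → Fin.punchIn-injective j _ _ (e (suc k))) (S-unique n))) (allFin (suc n))))
  (AllPairs.map⁺ (AllPairs.map (λ i≢j → All.map⁺ (All.universal (λ _ → All.map⁺ (All.universal (λ _ e → i≢j (e zero)) (S n))) (S n)))
    (Unique.allFin⁺ (suc n))))

-- w carries the entry in position i to position w(i).
infixr 7 _•_
_•_ : ∀ {n} {A : Set} → Permutation′ n → Vector A n → Vector A n
(w • v) i = v (w ⟨$⟩ˡ i)

ℓ : ∀ {n} → Permutation′ n → ℕ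
ℓ {n} w = length (filter (λ (i , j) → (i Fin.<? j) ×-dec (w ⟨$⟩ʳ j Fin.<? w ⟨$⟩ʳ i))
                         (cartesianProduct (allFin n) (allFin n)))

module _ {n : ℕ} (lam : Vector ℤ n) where

  Dominant : Set
  Dominant = ∀ i j → i Fin.≤ j → lam j ℤ.≤ lam i

  stabilizer : List (Permutation′ n)
  stabilizer = filter (λ v → Fin.all? (λ i → (v • lam) i ℤ.≟ lam i)) (S n)

  -- The identity is in the stabilizer, so it is a harmless default.
  longest : Permutation′ n
  longest = argmax ℓ Perm.id stabilizer

  multiplicity : ℤ → ℕ
  multiplicity i = length (filter (λ k → lam k ℤ.≟ i) (allFin n))

------------------------------------------------------------------------

data Var (n : ℕ) : Set where
  t½  : Var n
  x Y : Fin n → Var n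

_≟ᵛ_ : ∀ {n} → DecidableEquality (Var n)
t½  ≟ᵛ t½  = yes ≡.refl
t½  ≟ᵛ x _ = no λ ()
t½  ≟ᵛ Y _ = no λ ()
x _ ≟ᵛ t½  = no λ ()
x i ≟ᵛ x j = map′ (≡.cong x) (λ { ≡.refl → ≡.refl }) (i Fin.≟ j)
x _ ≟ᵛ Y _ = no λ ()
Y _ ≟ᵛ t½  = no λ ()
Y _ ≟ᵛ x _ = no λ ()
Y i ≟ᵛ Y j = map′ (≡.cong Y) (λ { ≡.refl → ≡.refl }) (i Fin.≟ j)

-- Rational functions in t^{1/2}, x_1,…,x_n, Y_1,…,Y_n over K; the standard
-- library has no ℂ, so K is arbitrary, K = ℂ giving the field
-- ℂ(t^{1/2}, x, Y).  The index i : Fin n stands for toℕ i + 1 ∈ {1,…,n}.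
module RationalFunctions {c ℓ′} (K : CommutativeRing c ℓ′) (n : ℕ) where

  open Polynomials K

  private
    R = polyRing (Var n)
    module R = CommutativeRing R

  open Fractions R public
  open CommutativeRing fractionRing public
  open Exp semiring public using (_^_)
  open MonoidSum *-commutativeMonoid public using () renaming (sum to ∏)

  ∑ : ∀ {a} {A : Set a} → List A → (A → Carrier) → Carrier
  ∑ xs f = foldr _+_ 0# (map f xs)

  infix 6 ∑
  syntax ∑ xs (λ w → f) = ∑[ w ∈ xs ] f

  -- ∏_{1 ≤ i < j ≤ n, λ_i = λ_j} f i j
  ∏< : Vector ℤ n → (∀ i j → i Fin.< j → Carrier) → Carrier
  ∏< lam f = ∏ λ i → ∏ λ j → factor (i Fin.<? j) (lam i ℤ.≟ lam j)
    where
    factor : ∀ {i j} → Dec (i Fin.< j) → Dec (lam i ≡ lam j) → Carrier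
    factor (yes i<j) (yes _) = f _ _ i<j
    factor (yes _)   (no _)  = 1#
    factor (no _)    _       = 1#

  record FiniteSupport (f : ℤ → Carrier) : Set (c ⊔ ℓ′) where
    field
      support        : List ℤ
      support-unique : Unique support
      outside        : ∀ i → i ∉ support → f i ≈ 1#

  -- A product over all of ℤ whose factors are 1 outside a finite set.
  ∏ᶻ : (f : ℤ → Carrier) → FiniteSupport f → Carrier
  ∏ᶻ f supp = foldr _*_ 1# (map f (FiniteSupport.support supp))

  private
    module Diff (u : Var n) where
      open DividedDifference _≟ᵛ_ u public

    var-con0 : ∀ u → var u R.- R.0# R.≈ var u
    var-con0 u = R.trans (R.+-congˡ (RingProperties.-0#≈0# R.ring)) (R.+-identityʳ (var u))

    var-regular : ∀ u → Regular (var u)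
    var-regular u = regular-cong (var-con0 u) (Diff.FreeOf-v.z-regular u R.0# R.refl R.refl)

    difference-regular : ∀ {u v} → v ≢ u → Regular (var u R.- var v)
    difference-regular {u} {v} v≢u = Diff.FreeOf-v.z-regular u (var v) ∂v σv
      where
      ∂v : Diff.∂ u (var v) (var v) ≋ R.0#
      ∂v with v ≟ᵛ u
      ... | yes v≡u = contradiction v≡u v≢u
      ... | no _    = ≋-refl
      σv : Diff.σ u (var v) (var v) ≋ var v
      σv with v ≟ᵛ u
      ... | yes v≡u = contradiction v≡u v≢u
      ... | no _    = ≋-refl

  gen gen⁻¹ : Var n → Carrier
  gen v   = ι (var v)
  gen⁻¹ v = R.1# / var v [ var-regular v ]

  -- t½^ k is t^{k/2}.
  t½^_ : ℤ → Carrier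
  t½^ (+ k)    = gen t½ ^ k
  t½^ -[1+ k ] = gen⁻¹ t½ ^ suc k

  t : Carrier
  t = t½^ (+ 2)

  private
    open SetoidReasoning setoid
    module ι = IsRingHomomorphism ι-isRingHomomorphism
    module R^ = Exp R.semiring
    module F^ = Exp semiring

    ι-^ : ∀ p m → ι (p R^.^ m) ≈ ι p ^ m
    ι-^ p zero    = refl
    ι-^ p (suc m) = trans (ι.*-homo p (p R^.^ m)) (*-congˡ (ι-^ p m))

  1-t^≠0 : ∀ d → 1 ℕ.≤ d → NonZero (1# - t ^ d)
  1-t^≠0 d 1≤d = nonZero-cong {f = ι (R.1# R.- z R^.^ (2 ℕ.* d))} (begin
    ι (R.1# R.- z R^.^ (2 ℕ.* d))          ≈⟨ ι.+-homo R.1# _ ⟩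
    1# + ι (R.- (z R^.^ (2 ℕ.* d)))        ≈⟨ +-congˡ (ι.-‿homo (z R^.^ (2 ℕ.* d))) ⟩
    1# - ι (z R^.^ (2 ℕ.* d))              ≈⟨ +-congˡ (-‿cong (ι-^ z (2 ℕ.* d))) ⟩
    1# - ι z ^ (2 ℕ.* d)                   ≈⟨ +-congˡ (-‿cong (F^.^-congˡ (2 ℕ.* d) (ι.⟦⟧-cong (var-con0 t½)))) ⟩
    1# - gen t½ ^ (2 ℕ.* d)                ≈⟨ +-congˡ (-‿cong (F^.^-assocʳ (gen t½) 2 d)) ⟨
    1# - t ^ d                             ∎)
    (Diff.FreeOf-v.1-z^m-regular t½ R.0# R.refl R.refl (2 ℕ.* d)
      (ℕ.≤-trans 1≤d (ℕ.m≤m+n d _)))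
    where
    z : Poly (Var n)
    z = var t½ R.- R.0#

  1-t≠0 : NonZero (1# - t)
  1-t≠0 = nonZero-cong (+-congˡ (-‿cong (*-identityʳ t))) (1-t^≠0 1 ℕ.≤-refl)

  opaque
    unfolding _*ᶠ_

    1-u⁻¹v≠0 : ∀ {u v} → v ≢ u → NonZero (1# - gen⁻¹ u * gen v)
    1-u⁻¹v≠0 {u} {v} v≢u = regular-cong (R.sym (R.+-cong
      (R.trans (R.*-identityˡ _) (R.*-identityʳ _))
      (R.trans (R.*-identityʳ _) (R.-‿cong (R.*-identityˡ _))))) (difference-regular v≢u)

  1-vu⁻¹≠0 : ∀ {u v} → v ≢ u → NonZero (1# - gen v * gen⁻¹ u)
  1-vu⁻¹≠0 {u} {v} v≢u = nonZero-cong (+-congˡ (-‿cong (*-comm (gen⁻¹ u) (gen v)))) (1-u⁻¹v≠0 v≢u)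

  1-xᵢ⁻¹xⱼ≠0 : ∀ {i j} → i Fin.< j → NonZero (1# - gen⁻¹ (x i) * gen (x j))
  1-xᵢ⁻¹xⱼ≠0 i<j = 1-u⁻¹v≠0 λ { ≡.refl → ℕ.<-irrefl ≡.refl i<j }

  1-YᵢYⱼ⁻¹≠0 : ∀ {i j} → i Fin.< j → NonZero (1# - gen (Y i) * gen⁻¹ (Y j))
  1-YᵢYⱼ⁻¹≠0 i<j = 1-vu⁻¹≠0 λ { ≡.refl → ℕ.<-irrefl ≡.refl i<j }

  permuteVar : Permutation′ n → Var n → Var n
  permuteVar w t½    = t½
  permuteVar w (x i) = x (w ⟨$⟩ʳ i)
  permuteVar w (Y i) = Y i

  rename : (Var n → Var n) → Poly (Var n) → Poly (Var n)
  rename σ = substitute (var ∘ σ)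

  rename-inverse : ∀ σ τ → (∀ v → σ (τ v) ≡ v) → ∀ p → rename σ (rename τ p) ≡ p
  rename-inverse σ τ inv (con k) = ≡.refl
  rename-inverse σ τ inv (var v) = ≡.cong var (inv v)
  rename-inverse σ τ inv (p ⊕ q) = ≡.cong₂ _⊕_ (rename-inverse σ τ inv p) (rename-inverse σ τ inv q)
  rename-inverse σ τ inv (p ⊗ q) = ≡.cong₂ _⊗_ (rename-inverse σ τ inv p) (rename-inverse σ τ inv q)
  rename-inverse σ τ inv (⊖ p)   = ≡.cong ⊖_ (rename-inverse σ τ inv p)

  private
    permuteVar-inverseˡ : ∀ w v → permuteVar (Perm.flip w) (permuteVar w v) ≡ v
    permuteVar-inverseˡ w t½    = ≡.refl
    permuteVar-inverseˡ w (x i) = ≡.cong x (Perm.inverseˡ w)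
    permuteVar-inverseˡ w (Y i) = ≡.refl

    permuteVar-inverseʳ : ∀ w v → permuteVar w (permuteVar (Perm.flip w) v) ≡ v
    permuteVar-inverseʳ w t½    = ≡.refl
    permuteVar-inverseʳ w (x i) = ≡.cong x (Perm.inverseʳ w)
    permuteVar-inverseʳ w (Y i) = ≡.refl

  rename-regular : ∀ w {s} → Regular s → Regular (rename (permuteVar w) s)
  rename-regular w {s} r p e =
    R.trans (R.reflexive (≡.sym (rename-inverse to from (permuteVar-inverseʳ w) p)))
      (substitute-cong (var ∘ to) (r (rename from p)
        (R.trans (R.*-congʳ (R.reflexive (≡.sym (rename-inverse from to (permuteVar-inverseˡ w) s))))
          (substitute-cong (var ∘ from) e))))
    where
    to   = permuteVar w
    from = permuteVar (Perm.flip w)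

  -- S_n permutes the x_i and fixes t^{1/2} and the Y_i.
  infixr 7 _·_
  _·_ : Permutation′ n → Carrier → Carrier
  w · f = rename (permuteVar w) (num f) / rename (permuteVar w) (den f) [ rename-regular w (den-regular f) ]

  K→F-isRingHomomorphism : IsRingHomomorphism (CommutativeRing.rawRing K) rawRing (ι ∘ con)
  K→F-isRingHomomorphism = Composition.isRingHomomorphism trans con-isRingHomomorphism ι-isRingHomomorphism

  open Evaluation fractionRing K→F-isRingHomomorphism public using (eval; eval-cong)

  -- f is defined at the point ρ: it can be written as a fraction whose
  -- denominator does not vanish there.
  record DefinedAt (ρ : Var n → Carrier) (f : Carrier) : Set (c ⊔ ℓ′) where
    field
      fraction    : Fraction
      represents  : f ≈ fraction
      nonvanishing : NonZero (eval ρ (den fraction))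

    value : Carrier
    value = eval ρ (num fraction) ÷ eval ρ (den fraction) [ nonvanishing ]

  value-unique : ∀ {ρ f} (d e : DefinedAt ρ f) → DefinedAt.value d ≈ DefinedAt.value e
  value-unique {ρ} d e = ÷-cong-cross d.nonvanishing e.nonvanishing
    (eval-cong ρ (cross (trans (sym d.represents) e.represents)))
    where
    module d = DefinedAt d
    module e = DefinedAt e

  -- The point of ev^t_0: Y_i ↦ t^{-(i-1) + (n-1)/2}, all else fixed.
  ev₀ : Var n → Carrier
  ev₀ t½    = gen t½
  ev₀ (x i) = gen (x i)
  ev₀ (Y i) = t½^ (+ (n ℕ.∸ 1) ℤ.- + (2 ℕ.* toℕ i))

  cˣ : Vector ℤ n → Carrier
  cˣ lam = ∏< lam λ i j i<j →
    (t½^ (ℤ.- + 1) - t½^ (+ 1) * (gen⁻¹ (x i) * gen (x j))) ÷ (1# - gen⁻¹ (x i) * gen (x j)) [ 1-xᵢ⁻¹xⱼ≠0 i<j ]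

  cʸ : Vector ℤ n → Carrier
  cʸ lam = ∏< lam λ i j i<j →
    (t½^ (ℤ.- + 1) - t½^ (+ 1) * (gen (Y i) * gen⁻¹ (Y j))) ÷ (1# - gen (Y i) * gen⁻¹ (Y j)) [ 1-YᵢYⱼ⁻¹≠0 i<j ]

  -- W_λ(t)
  poincaré : Vector ℤ n → Carrier
  poincaré lam = ∑[ w ∈ stabilizer lam ] t ^ ℓ w

  -- [m]! = ∏_{d=1}^m (1 - t^d)/(1 - t); the index d below is d - 1.
  [_]! : ℕ → Carrier
  [ m ]! = ∏ {m} λ d → (1# - t ^ suc (toℕ d)) ÷ (1# - t) [ 1-t≠0 ]

  [multiplicity]!-support : ∀ lam → FiniteSupport (λ i → [ multiplicity lam i ]!)
  [multiplicity]!-support lam = record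
    { support        = deduplicate ℤ._≟_ (tabulate lam)
    ; support-unique = deduplicate-! ℤ._≟_ (tabulate lam)
    ; outside        = λ i i∉ → reflexive (≡.cong (λ ks → [ length ks ]!)
        (filter-none (λ k → lam k ℤ.≟ i) (All.universal (λ { k ≡.refl → i∉
          (Mem.∈-deduplicate⁺ ℤ._≟_ (Mem.∈-tabulate⁺ {f = lam} k)) }) (allFin n))))
    }

{-# OPTIONS --safe #-}
module Submission where

open import Defs
open import Algebra.Bundles using (CommutativeMonoid; CommutativeRing)
open import Algebra.Morphism.Structures using (IsRingHomomorphism)
import Algebra.Properties.CommutativeMonoid.Sum as MonoidSum
import Algebra.Properties.CommutativeSemigroup as CommutativeSemigroupProperties
import Algebra.Properties.Ring as RingProperties
import Algebra.Properties.Semiring.Exp as Exp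
import Algebra.Properties.Semiring.Sum as SemiringSum
import Algebra.Solver.Ring.NaturalCoefficients.Default as Solver
open import Data.Bool using (Bool; true; false; if_then_else_; _∧_)
open import Data.Fin using (toℕ)
open import Data.Fin as Fin using (Fin; zero; suc; inject≤; punchIn)
open import Data.Fin.Permutation as Perm using (Permutation′; _⟨$⟩ʳ_; _⟨$⟩ˡ_)
import Data.Fin.Properties as Fin
open import Data.Integer as ℤ using (ℤ; +_; -[1+_])
import Data.Integer.Properties as ℤ
open import Data.Integer.Tactic.RingSolver using (solve-∀)
open import Data.List using (List; []; _∷_; _++_; foldr; map; filter; concatMap; cartesianProduct; allFin; tabulate; length)
open import Data.List.Membership.Propositional using (_∈_)
import Data.List.Membership.Propositional.Properties as Mem
import Data.List.Properties as List
open import Data.List.Relation.Unary.All as All using (All; []; _∷_)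
open import Data.List.Relation.Unary.AllPairs using (_∷_)
open import Data.List.Relation.Unary.Any as Any using (here; there)
open import Data.List.Relation.Unary.Unique.Propositional using (Unique)
open import Data.Nat as ℕ using (ℕ; zero; suc; z≤n; s≤s)
open import Data.Nat.Properties using (m<n⇒0<n∸m)
import Data.Nat.Properties as ℕ
import Data.List.Extrema ℕ.≤-totalOrder as Extrema
open import Data.Product using (Σ; _×_; _,_; ∃; proj₁; proj₂)
open import Data.Vec.Functional using (Vector)
open import Function using (_∘_; id; _⇔_; mk⇔; Equivalence)
open import Level using (_⊔_)
open import Relation.Binary.PropositionalEquality as ≡ using (_≡_; _≢_)
import Relation.Binary.Reasoning.Setoid as SetoidReasoning
open import Relation.Nullary using (Dec; yes; no; does; ¬_; contradiction)
open import Relation.Nullary.Decidable using (_×-dec_; does-⇔)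
open import Relation.Unary using (Decidable)

-- Everything goes by induction on n.  As λ is dominant, the entries equal to λ_1 form an initial
-- segment 1, …, m, and a permutation in W_λ is given by the image j ≤ m of 1 together with an
-- element ρ of the stabilizer of (λ_2, …, λ_n); its length is j - 1 + ℓ(ρ).  Hence
-- W_λ(t) = (1 + t + ⋯ + t^{m-1}) W_{(λ_2, …, λ_n)}(t), and both products satisfy the same recursion.
-- The symmetrized sum satisfies it because ∑_{j ≤ m} ∏_{k ≠ j} (x_j - t x_k)/(x_j - x_k) =
-- 1 + t + ⋯ + t^{m-1}, which is the divided difference of ∏_k (z - t x_k) at 0, x_1, …, x_m.
-- The formula for t^{-ℓ(w_λ)/2} W_λ(t) differs by one factor t^{-1/2} for each pair
-- i < j with λ_i = λ_j, and the number of these pairs is ℓ(w_λ).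

-- Two obstacles shape the proof. In the symmetrized sum, fixing the image j of 1 leaves the
-- variables x_k with k ≠ j instead of x_2, ..., x_n, so an induction on the given rational
-- functions does not close up. It is therefore run for an abstract `Kernel`, a family r i j with
-- the algebraic properties of (x_i - t x_j)/(x_i - x_j), which survives restriction to fewer
-- indices. The value W_λ(t) does not depend on the kernel, so the sum over ρ is the same for every
-- j and factors out. Secondly, K is any commutative ring and the ring of fractions need not be a
-- field: quotients are handled through relations with cleared denominators, and only regular
-- elements such as 1 - t are cancelled. The divided difference equals 1 because it is that of a
-- monic polynomial of degree m at m + 1 nodes.

module FiniteSums {c ℓ} (M : CommutativeMonoid c ℓ) where

  open CommutativeMonoid M
  open SetoidReasoning setoid
  open MonoidSum M public using (sum; sum-cong-≋; sum-cong-≗; sum-remove; sum-permute; sum-init-last; ∑-distrib-+; sum-replicate; sum-replicate-zero)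

  -- Conditional terms, and sums over `Fin n` and over lists.

  infix 8 [_]·_
  -- Takes a Boolean rather than a decision, so that equivalent tests can be exchanged by `does-⇔`
  -- and conjunctions split by `[]·-∧`. Excluded terms become ε, so the index set stays all of
  -- `Fin n` and can still be permuted.
  [_]·_ : Bool → Carrier → Carrier
  [ b ]· a = if b then a else ε

  []·-cong : ∀ {b b′ a a′} → b ≡ b′ → a ≈ a′ → [ b ]· a ≈ [ b′ ]· a′
  []·-cong {true}  ≡.refl e = e
  []·-cong {false} ≡.refl e = refl

  []·-cong-does : ∀ {p} {P : Set p} (P? : Dec P) {a a′} → (P → a ≈ a′) → [ does P? ]· a ≈ [ does P? ]· a′
  []·-cong-does (yes p) e = e p
  []·-cong-does (no _)  e = refl

  []·-yes : ∀ {p} {P : Set p} (P? : Dec P) {a} → P → [ does P? ]· a ≈ a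
  []·-yes (yes _) p = refl
  []·-yes (no ¬p) p = contradiction p ¬p

  []·-no : ∀ {p} {P : Set p} (P? : Dec P) {a} → ¬ P → [ does P? ]· a ≈ ε
  []·-no (yes p) ¬p = contradiction p ¬p
  []·-no (no _)  ¬p = refl

  []·-∧ : ∀ b b′ a → [ b ∧ b′ ]· a ≈ [ b ]· [ b′ ]· a
  []·-∧ true  b′ a = refl
  []·-∧ false b′ a = refl

  []·-∙ : ∀ b a a′ → [ b ]· (a ∙ a′) ≈ [ b ]· a ∙ [ b ]· a′
  []·-∙ true  a a′ = refl
  []·-∙ false a a′ = sym (identityˡ ε)

  sum-ε : ∀ {n} {f : Fin n → Carrier} → (∀ i → f i ≈ ε) → sum f ≈ ε
  sum-ε {n} e = trans (sum-cong-≋ e) (sum-replicate-zero n)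

  sum-inject≤ : ∀ {m n} (m≤n : m ℕ.≤ n) (f : Fin n → Carrier) → (∀ i → m ℕ.≤ toℕ i → f i ≈ ε) →
                sum f ≈ sum λ i → f (inject≤ i m≤n)
  sum-inject≤ {zero}  {n}     m≤n       f e = sum-ε λ i → e i z≤n
  sum-inject≤ {suc m} {suc n} (s≤s m≤n) f e = ∙-congˡ (sum-inject≤ m≤n (f ∘ suc) λ i m≤i → e (suc i) (s≤s m≤i))

  sum-initial : ∀ {m n p} {P : Fin n → Set p} (P? : ∀ i → Dec (P i)) (m≤n : m ℕ.≤ n) →
                (∀ i → toℕ i ℕ.< m → P i) → (∀ i → m ℕ.≤ toℕ i → ¬ P i) → (f : Fin n → Carrier) →
                sum (λ i → [ does (P? i) ]· f i) ≈ sum λ i → f (inject≤ i m≤n)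
  sum-initial P? m≤n in-P out-P f = trans
    (sum-inject≤ m≤n _ λ i m≤i → []·-no (P? i) (out-P i m≤i))
    (sum-cong-≋ λ i → []·-yes (P? (inject≤ i m≤n)) (in-P _ (≡.subst (ℕ._< _) (≡.sym (Fin.toℕ-inject≤ i m≤n)) (Fin.toℕ<n i))))

  ∑ : ∀ {a} {A : Set a} → List A → (A → Carrier) → Carrier
  ∑ xs f = foldr _∙_ ε (map f xs)

  ∑-cong : ∀ {a} {A : Set a} (xs : List A) {f g : A → Carrier} → (∀ x → f x ≈ g x) → ∑ xs f ≈ ∑ xs g
  ∑-cong []       e = refl
  ∑-cong (y ∷ xs) e = ∙-cong (e y) (∑-cong xs e)

  ∑-++ : ∀ {a} {A : Set a} (xs ys : List A) f → ∑ (xs ++ ys) f ≈ ∑ xs f ∙ ∑ ys f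
  ∑-++ []       ys f = sym (identityˡ _)
  ∑-++ (y ∷ xs) ys f = trans (∙-congˡ (∑-++ xs ys f)) (sym (assoc _ _ _))

  ∑-map : ∀ {a b} {A : Set a} {B : Set b} (h : A → B) xs f → ∑ (map h xs) f ≈ ∑ xs (f ∘ h)
  ∑-map h xs f = reflexive (≡.cong (foldr _∙_ ε) (≡.sym (List.map-∘ xs)))

  ∑-concatMap : ∀ {a b} {A : Set a} {B : Set b} (h : A → List B) xs f →
                ∑ (concatMap h xs) f ≈ ∑ xs λ x → ∑ (h x) f
  ∑-concatMap h []       f = refl
  ∑-concatMap h (y ∷ xs) f = trans (∑-++ (h y) (concatMap h xs) f) (∙-congˡ (∑-concatMap h xs f))

  ∑-tabulate : ∀ {a} {A : Set a} {n} (h : Fin n → A) f → ∑ (tabulate h) f ≈ sum (f ∘ h)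
  ∑-tabulate {n = zero}  h f = refl
  ∑-tabulate {n = suc n} h f = ∙-congˡ (∑-tabulate (h ∘ suc) f)

  ∑-allFin : ∀ n f → ∑ (allFin n) f ≈ sum f
  ∑-allFin n = ∑-tabulate id

  ∑-cartesianProduct : ∀ {a b} {A : Set a} {B : Set b} (xs : List A) (ys : List B) f →
                       ∑ (cartesianProduct xs ys) f ≈ ∑ xs λ x → ∑ ys λ y → f (x , y)
  ∑-cartesianProduct []       zs f = refl
  ∑-cartesianProduct (y ∷ xs) zs f = trans (∑-++ (map (y ,_) zs) (cartesianProduct xs zs) f)
    (∙-cong (∑-map (y ,_) zs f) (∑-cartesianProduct xs zs f))

  ∑-filter : ∀ {a p} {A : Set a} {P : A → Set p} (P? : Decidable P) xs f →
             ∑ (filter P? xs) f ≈ ∑ xs λ x → [ does (P? x) ]· f x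
  ∑-filter P? []       f = refl
  ∑-filter P? (y ∷ xs) f with does (P? y)
  ... | true  = ∙-congˡ (∑-filter P? xs f)
  ... | false = trans (∑-filter P? xs f) (sym (identityˡ _))

-- Divided differences at nodes with invertible differences.

module DividedDifferences {c ℓ} (F : CommutativeRing c ℓ) where

  open CommutativeRing F hiding (zero)
  open RingProperties ring using (+-identityˡ-unique; //-rightDividesˡ)
  open SetoidReasoning setoid
  open SemiringSum semiring using (*-distribˡ-sum)
  private
    module Sum = FiniteSums +-commutativeMonoid
    module Prod = FiniteSums *-commutativeMonoid

  -‿telescope : ∀ a b c → (a - b) + (b - c) ≈ a - c
  -‿telescope a b c = begin
    (a - b) + (b - c)   ≈⟨ +-assoc (a - b) b (- c) ⟨
    (a - b) + b - c     ≈⟨ +-congʳ (//-rightDividesˡ b a) ⟩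
    a - c               ∎

  -- For pairwise distinct nodes z, the divided difference of f at z is
  -- Σ_j f j ∏_{k≠j} (z j - z k)⁻¹; in δ those inverses are completed by 1 on the diagonal.
  record IsInverse {m} (z : Fin m → Carrier) (δ : Fin m → Fin m → Carrier) : Set ℓ where
    field
      diagonal : ∀ i → δ i i ≈ 1#
      inverse  : ∀ {i j} → i ≢ j → (z i - z j) * δ i j ≈ 1#

  open IsInverse

  remove-node : ∀ {m} → Fin (suc m) → (Fin (suc m) → Fin (suc m) → Carrier) → Fin m → Fin m → Carrier
  remove-node i δ a b = δ (punchIn i a) (punchIn i b)

  remove-node-isInverse : ∀ {m} i {z : Fin (suc m) → Carrier} {δ} →
                          IsInverse z δ → IsInverse (z ∘ punchIn i) (remove-node i δ)
  remove-node-isInverse i inv = record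
    { diagonal = λ a → diagonal inv (punchIn i a)
    ; inverse  = λ a≢b → inverse inv (a≢b ∘ Fin.punchIn-injective i _ _) }

  -- Opaque only to help unification.
  opaque
    div-diff : ∀ {m} → (Fin m → Fin m → Carrier) → (Fin m → Carrier) → Carrier
    div-diff δ f = Sum.sum λ j → f j * Prod.sum (δ j)

    div-diff-unfold : ∀ {m} (δ : Fin m → Fin m → Carrier) f → div-diff δ f ≈ Sum.sum λ j → f j * Prod.sum (δ j)
    div-diff-unfold δ f = refl

    div-diff-cong : ∀ {m} (δ : Fin m → Fin m → Carrier) {f g} → (∀ j → f j ≈ g j) → div-diff δ f ≈ div-diff δ g
    div-diff-cong δ e = Sum.sum-cong-≋ λ j → *-congʳ (e j)

    div-diff-+ : ∀ {m} (δ : Fin m → Fin m → Carrier) f g →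
                 div-diff δ (λ j → f j + g j) ≈ div-diff δ f + div-diff δ g
    div-diff-+ δ f g = trans (Sum.sum-cong-≋ λ j → distribʳ (Prod.sum (δ j)) (f j) (g j))
      (Sum.∑-distrib-+ (λ j → f j * Prod.sum (δ j)) (λ j → g j * Prod.sum (δ j)))

    div-diff-* : ∀ {m} (δ : Fin m → Fin m → Carrier) a f → div-diff δ (λ j → a * f j) ≈ a * div-diff δ f
    div-diff-* δ a f = trans (Sum.sum-cong-≋ λ j → *-assoc a (f j) (Prod.sum (δ j)))
      (sym (*-distribˡ-sum a λ j → f j * Prod.sum (δ j)))

    -- The factor z j - z i kills the term j = i and cancels against δ j i in every other term, so
    -- the node i drops out.
    div-diff-factor : ∀ {m} i {z : Fin (suc m) → Carrier} {δ} → IsInverse z δ → ∀ f →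
                      div-diff δ (λ j → (z j - z i) * f j) ≈ div-diff (remove-node i δ) (f ∘ punchIn i)
    div-diff-factor i {z} {δ} inv f = begin
      div-diff δ (λ j → (z j - z i) * f j)
        ≈⟨ Sum.sum-remove {i = i} (λ j → (z j - z i) * f j * Prod.sum (δ j)) ⟩
      (z i - z i) * f i * Prod.sum (δ i) + Sum.sum (λ a → (z (punchIn i a) - z i) * f (punchIn i a) * Prod.sum (δ (punchIn i a)))
        ≈⟨ +-cong (trans (*-congʳ (trans (*-congʳ (-‿inverseʳ (z i))) (zeroˡ _))) (zeroˡ _))
                  (Sum.sum-cong-≋ λ a → cancel-δ (punchIn i a) (Fin.punchInᵢ≢i i a)) ⟩
      0# + div-diff (remove-node i δ) (f ∘ punchIn i)
        ≈⟨ +-identityˡ _ ⟩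
      div-diff (remove-node i δ) (f ∘ punchIn i) ∎
      where
      cancel-δ : ∀ j → j ≢ i → (z j - z i) * f j * Prod.sum (δ j) ≈ f j * Prod.sum (δ j ∘ punchIn i)
      cancel-δ j j≢i = begin
        (z j - z i) * f j * Prod.sum (δ j)
          ≈⟨ *-cong (*-comm _ _) (Prod.sum-remove {i = i} (δ j)) ⟩
        f j * (z j - z i) * (δ j i * Prod.sum (δ j ∘ punchIn i))
          ≈⟨ *-assoc _ _ _ ⟩
        f j * ((z j - z i) * (δ j i * Prod.sum (δ j ∘ punchIn i)))
          ≈⟨ *-congˡ (sym (*-assoc _ _ _)) ⟩
        f j * ((z j - z i) * δ j i * Prod.sum (δ j ∘ punchIn i))
          ≈⟨ *-congˡ (trans (*-congʳ (inverse inv j≢i)) (*-identityˡ _)) ⟩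
        f j * Prod.sum (δ j ∘ punchIn i) ∎

    div-diff-singleton : ∀ {z : Fin 1 → Carrier} {δ} → IsInverse z δ → div-diff δ (λ _ → 1#) ≈ 1#
    div-diff-singleton inv = trans (+-identityʳ _) (trans (*-identityˡ _) (trans (*-identityʳ _) (diagonal inv zero)))

  -- The functions z j - z 0 and z j - z 1 differ by the constant z 1 - z 0. By `div-diff-factor`
  -- their divided differences are those of 1 without node 0 and without node 1, and these agree:
  -- both are 1 if a single node is left, both are 0 by recursion otherwise. Hence z 1 - z 0, which
  -- δ 1 0 inverts, annihilates the divided difference of 1.
  div-diff-1 : ∀ m {z : Fin (suc (suc m)) → Carrier} {δ} → IsInverse z δ → div-diff δ (λ _ → 1#) ≈ 0#
  div-diff-1 m {z} {δ} inv = begin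
    div-diff δ (λ _ → 1#)
      ≈⟨ *-identityˡ _ ⟨
    1# * div-diff δ (λ _ → 1#)
      ≈⟨ *-congʳ (trans (*-comm _ _) (inverse inv {suc zero} {zero} λ ())) ⟨
    δ (suc zero) zero * (z (suc zero) - z zero) * div-diff δ (λ _ → 1#)
      ≈⟨ *-assoc _ _ _ ⟩
    δ (suc zero) zero * ((z (suc zero) - z zero) * div-diff δ (λ _ → 1#))
      ≈⟨ *-congˡ vanish ⟩
    δ (suc zero) zero * 0#
      ≈⟨ zeroʳ _ ⟩
    0# ∎
    where
    removed : Fin (suc (suc m)) → Carrier
    removed i = div-diff (remove-node i δ) (λ _ → 1#)

    removed-equal : ∀ m {z : Fin (suc (suc m)) → Carrier} {δ} → IsInverse z δ →
                    div-diff (remove-node zero δ) (λ _ → 1#) ≈ div-diff (remove-node (suc zero) δ) (λ _ → 1#)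
    removed-equal zero    inv = trans (div-diff-singleton (remove-node-isInverse zero inv))
                                  (sym (div-diff-singleton (remove-node-isInverse (suc zero) inv)))
    removed-equal (suc m) inv = trans (div-diff-1 m (remove-node-isInverse zero inv))
                                  (sym (div-diff-1 m (remove-node-isInverse (suc zero) inv)))

    factor : ∀ i → div-diff δ (λ j → z j - z i) ≈ removed i
    factor i = trans (div-diff-cong δ λ j → sym (*-identityʳ _)) (div-diff-factor i inv λ _ → 1#)

    vanish : (z (suc zero) - z zero) * div-diff δ (λ _ → 1#) ≈ 0#
    vanish = +-identityˡ-unique _ _ (begin
      (z (suc zero) - z zero) * div-diff δ (λ _ → 1#) + removed zero
        ≈⟨ +-congˡ (removed-equal m inv) ⟩
      (z (suc zero) - z zero) * div-diff δ (λ _ → 1#) + removed (suc zero)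
        ≈⟨ +-cong (sym (div-diff-* δ _ _)) (sym (factor (suc zero))) ⟩
      div-diff δ (λ _ → (z (suc zero) - z zero) * 1#) + div-diff δ (λ j → z j - z (suc zero))
        ≈⟨ div-diff-+ δ _ _ ⟨
      div-diff δ (λ j → (z (suc zero) - z zero) * 1# + (z j - z (suc zero)))
        ≈⟨ div-diff-cong δ (λ j → trans (+-congʳ (*-identityʳ _)) (trans (+-comm _ _) (-‿telescope _ _ _))) ⟩
      div-diff δ (λ j → z j - z zero)
        ≈⟨ factor zero ⟩
      removed zero ∎)

  private
    -- z - a₀ = (z - z₀) + (z₀ - a₀) splits off the node z₀.
    split : ∀ {m d} {z : Fin (suc m) → Carrier} {δ} → IsInverse z δ → (a : Fin (suc d) → Carrier) →
            div-diff δ (λ j → Prod.sum λ k → z j - a k)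
              ≈ div-diff (remove-node zero δ) (λ j → Prod.sum λ k → z (suc j) - a (suc k))
                + (z zero - a zero) * div-diff δ (λ j → Prod.sum λ k → z j - a (suc k))
    split {z = z} {δ} inv a = begin
      div-diff δ (λ j → (z j - a zero) * g j)
        ≈⟨ div-diff-cong δ (λ j → trans (*-congʳ (sym (-‿telescope (z j) (z zero) (a zero)))) (distribʳ _ _ _)) ⟩
      div-diff δ (λ j → (z j - z zero) * g j + (z zero - a zero) * g j)
        ≈⟨ div-diff-+ δ _ _ ⟩
      div-diff δ (λ j → (z j - z zero) * g j) + div-diff δ (λ j → (z zero - a zero) * g j)
        ≈⟨ +-cong (div-diff-factor zero inv g) (div-diff-* δ _ g) ⟩
      div-diff (remove-node zero δ) (g ∘ suc) + (z zero - a zero) * div-diff δ g ∎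
      where
      g : Fin _ → Carrier
      g j = Prod.sum λ k → z j - a (suc k)

  -- `split` removes a factor from the polynomial in both of its summands and a node in only one of
  -- them, so the degree stays below m throughout the recursion, which ends at the constant 1.
  div-diff-low-degree : ∀ m d {z : Fin (suc m) → Carrier} {δ} → IsInverse z δ → d ℕ.< m →
                        (a : Fin d → Carrier) → div-diff δ (λ j → Prod.sum λ k → z j - a k) ≈ 0#
  div-diff-low-degree (suc m) zero    inv d<m a = div-diff-1 m inv
  div-diff-low-degree (suc m) (suc d) inv (s≤s d<m) a = begin
    _            ≈⟨ split inv a ⟩
    _            ≈⟨ +-cong (div-diff-low-degree m d (remove-node-isInverse zero inv) d<m (a ∘ suc))
                           (*-congˡ (div-diff-low-degree (suc m) d inv (ℕ.m≤n⇒m≤1+n d<m) (a ∘ suc))) ⟩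
    0# + _ * 0#  ≈⟨ trans (+-identityˡ _) (zeroʳ _) ⟩
    0#           ∎

  -- In `split` the second summand has too low a degree for its nodes and vanishes; the first is the
  -- same claim with one node and one factor fewer.
  div-diff-monic : ∀ m {z : Fin (suc m) → Carrier} {δ} → IsInverse z δ →
                   (a : Fin m → Carrier) → div-diff δ (λ j → Prod.sum λ k → z j - a k) ≈ 1#
  div-diff-monic zero    inv a = div-diff-singleton inv
  div-diff-monic (suc m) inv a = begin
    _            ≈⟨ split inv a ⟩
    _            ≈⟨ +-cong (div-diff-monic m (remove-node-isInverse zero inv) (a ∘ suc))
                           (*-congˡ (div-diff-low-degree (suc m) m inv ℕ.≤-refl (a ∘ suc))) ⟩
    1# + _ * 0#  ≈⟨ trans (+-congˡ (zeroʳ _)) (+-identityʳ _) ⟩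
    1#           ∎

-- Geometric sums in t and the kernel identity.

Cancels1- : ∀ {c ℓ} (F : CommutativeRing c ℓ) → CommutativeRing.Carrier F → Set (c ⊔ ℓ)
Cancels1- F t = ∀ {a b} → (1# - t) * a ≈ (1# - t) * b → a ≈ b
  where open CommutativeRing F

module GeometricSums {c ℓ} (F : CommutativeRing c ℓ) (t : CommutativeRing.Carrier F)
  (cancel-1-t : Cancels1- F t) where

  open CommutativeRing F hiding (zero)

  open DividedDifferences F
  open IsInverse using (inverse)
  open CommutativeSemigroupProperties *-commutativeSemigroup using (x∙yz≈y∙xz)
  open RingProperties ring using (-‿distribˡ-*; -‿distribʳ-*; -0#≈0#; -‿involutive; +-cancelˡ; x[y-z]≈xy-xz; [y-z]x≈yx-zx)
  open SetoidReasoning setoid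
  open SemiringSum semiring using (*-distribˡ-sum)
  open Exp semiring using (_^_)
  private
    module Sum = FiniteSums +-commutativeMonoid
    module Prod = FiniteSums *-commutativeMonoid

  [1-t]* : ∀ a → (1# - t) * a ≈ a - t * a
  [1-t]* a = trans ([y-z]x≈yx-zx a 1# t) (+-congʳ (*-identityˡ a))

  geometric : ℕ → Carrier
  geometric m = Sum.sum {m} λ i → t ^ toℕ i

  geometric-suc : ∀ m → geometric (suc m) ≈ 1# + t * geometric m
  geometric-suc m = +-congˡ (sym (*-distribˡ-sum t λ i → t ^ toℕ {m} i))

  geometric-closed : ∀ m → (1# - t) * geometric m ≈ 1# - t ^ m
  geometric-closed zero    = trans (zeroʳ _) (sym (-‿inverseʳ 1#))
  geometric-closed (suc m) = begin
    (1# - t) * geometric (suc m)               ≈⟨ *-congˡ (geometric-suc m) ⟩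
    (1# - t) * (1# + t * geometric m)          ≈⟨ distribˡ _ _ _ ⟩
    (1# - t) * 1# + (1# - t) * (t * geometric m)  ≈⟨ +-cong (*-identityʳ _) (trans (x∙yz≈y∙xz _ _ _) (*-congˡ (geometric-closed m))) ⟩
    (1# - t) + t * (1# - t ^ m)                ≈⟨ +-congˡ (trans (x[y-z]≈xy-xz t 1# (t ^ m)) (+-congʳ (*-identityʳ t))) ⟩
    (1# - t) + (t - t * t ^ m)                 ≈⟨ -‿telescope 1# t (t * t ^ m) ⟩
    1# - t * t ^ m                             ∎

  -- The hypothesis is q d = (1 - t^{d+1})/(1 - t^d) for d ≥ 1 with the denominator cleared, so q 1
  -- ⋯ q m telescopes to (1 - t^{m+1})/(1 - t).
  geometric-product : ∀ m (q : ℕ → Carrier) → (∀ d → q (suc d) * (1# - t ^ suc d) ≈ 1# - t ^ suc (suc d)) →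
                      Prod.sum {m} (λ i → q (suc (toℕ i))) ≈ geometric (suc m)
  geometric-product m q q-ratio = cancel-1-t (begin
    (1# - t) * Prod.sum {m} (λ i → q (suc (toℕ i)))       ≈⟨ *-comm _ _ ⟩
    Prod.sum {m} (λ i → q (suc (toℕ i))) * (1# - t)       ≈⟨ *-cong (Prod.sum-cong-≋ {m} λ i → reflexive (≡.cong q (ℕ.+-comm 1 (toℕ i)))) (+-congˡ (-‿cong (sym (*-identityʳ t)))) ⟩
    Prod.sum {m} (λ i → q (toℕ i ℕ.+ 1)) * (1# - t ^ 1)   ≈⟨ telescope m 1 ⟩
    1# - t ^ (m ℕ.+ 1)                                 ≡⟨ ≡.cong (λ d → 1# - t ^ d) (ℕ.+-comm m 1) ⟩
    1# - t ^ suc m                                     ≈⟨ geometric-closed (suc m) ⟨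
    (1# - t) * geometric (suc m)                       ∎)
    where
    -- A variable start d lets the induction absorb the first factor into 1 - t^d.
    telescope : ∀ m d .{{_ : ℕ.NonZero d}} → Prod.sum {m} (λ i → q (toℕ i ℕ.+ d)) * (1# - t ^ d) ≈ 1# - t ^ (m ℕ.+ d)
    telescope zero    d = *-identityˡ _
    telescope (suc m) (suc d) = begin
      q (suc d) * Prod.sum {m} (λ i → q (suc (toℕ i ℕ.+ suc d))) * (1# - t ^ suc d)
        ≈⟨ trans (*-congʳ (*-comm _ _)) (*-assoc _ _ _) ⟩
      Prod.sum {m} (λ i → q (suc (toℕ i ℕ.+ suc d))) * (q (suc d) * (1# - t ^ suc d))
        ≈⟨ *-cong (Prod.sum-cong-≋ {m} λ i → reflexive (≡.cong q (≡.sym (ℕ.+-suc (toℕ i) (suc d))))) (q-ratio d) ⟩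
      Prod.sum {m} (λ i → q (toℕ i ℕ.+ suc (suc d))) * (1# - t ^ suc (suc d))
        ≈⟨ telescope m (suc (suc d)) ⟩
      1# - t ^ (m ℕ.+ suc (suc d))
        ≡⟨ ≡.cong (λ e → 1# - t ^ e) (ℕ.+-suc m (suc d)) ⟩
      1# - t ^ suc (m ℕ.+ suc d) ∎

  -- r i j stands for (x_i - t x_j) / (x_i - x_j), completed by 1 on the diagonal.
  record Kernel {N} (r : Fin N → Fin N → Carrier) : Set (c ⊔ ℓ) where
    field
      z z⁻¹     : Fin N → Carrier
      z-inverse : ∀ i → z i * z⁻¹ i ≈ 1#
      δ         : Fin N → Fin N → Carrier
      δ-inverse : IsInverse z δ
      diagonal  : ∀ i → r i i ≈ 1#
      ratio     : ∀ {i j} → i ≢ j → r i j * (z i - z j) ≈ z i - t * z j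

  -- Used in two ways: along `punchIn j`, to drop the variable chosen as image of the first
  -- position, and along `inject≤`, to keep only the variables of the first block.
  restrict : ∀ {N m r} (e : Fin m → Fin N) → (∀ {i j} → e i ≡ e j → i ≡ j) → Kernel r → Kernel (λ i j → r (e i) (e j))
  restrict e e-injective κ = record
    { z = z ∘ e ; z⁻¹ = z⁻¹ ∘ e ; z-inverse = z-inverse ∘ e ; δ = λ i j → δ (e i) (e j)
    ; δ-inverse = record { diagonal = IsInverse.diagonal δ-inverse ∘ e ; inverse = λ i≢j → inverse δ-inverse (i≢j ∘ e-injective) }
    ; diagonal = diagonal ∘ e ; ratio = λ i≢j → ratio (i≢j ∘ e-injective) }
    where open Kernel κ

  -- The divided difference of ∏_k (z - t x_k) at the nodes 0, x_0, …, x_{m-1} is 1; the node 0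
  -- contributes t^m and x_j contributes (1 - t) ∏_k r j k.
  sum-kernel : ∀ {m r} → Kernel {m} r → Sum.sum (λ j → Prod.sum (r j)) ≈ geometric m
  sum-kernel {m} {r} κ = cancel-1-t (+-cancelˡ (t ^ m) _ _ (begin
    t ^ m + (1# - t) * Sum.sum (λ j → Prod.sum (r j))
      ≈⟨ +-cong (sym zero-term) (trans (*-distribˡ-sum (1# - t) (λ j → Prod.sum (r j))) (Sum.sum-cong-≋ (sym ∘ x-term))) ⟩
    f zero * Prod.sum (δ⁺ zero) + Sum.sum (λ j → f (suc j) * Prod.sum (δ⁺ (suc j)))
      ≈⟨ div-diff-unfold δ⁺ f ⟨
    div-diff δ⁺ f
      ≈⟨ div-diff-monic m δ⁺-inverse (λ k → t * z k) ⟩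
    1#
      ≈⟨ trans (sym (+-identityʳ 1#)) (+-congˡ (sym (-‿inverseʳ (t ^ m)))) ⟩
    1# + (t ^ m - t ^ m)
      ≈⟨ trans (sym (+-assoc _ _ _)) (trans (+-congʳ (+-comm _ _)) (+-assoc _ _ _)) ⟩
    t ^ m + (1# - t ^ m)
      ≈⟨ +-congˡ (geometric-closed m) ⟨
    t ^ m + (1# - t) * geometric m ∎))
    where
    open Kernel κ
    z⁺ : Fin (suc m) → Carrier
    z⁺ zero    = 0#
    z⁺ (suc i) = z i

    f : Fin (suc m) → Carrier
    f j = Prod.sum λ k → z⁺ j - t * z k

    -- The extra node 0 has differences 0 - z k and z j - 0 with the other nodes; this is where the
    -- invertibility of the z k enters.
    δ⁺ : Fin (suc m) → Fin (suc m) → Carrier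
    δ⁺ zero    zero    = 1#
    δ⁺ zero    (suc k) = - z⁻¹ k
    δ⁺ (suc j) zero    = z⁻¹ j
    δ⁺ (suc j) (suc k) = δ j k

    0-‿ : ∀ a → 0# - a ≈ - a
    0-‿ a = +-identityˡ (- a)

    -*- : ∀ a b → - a * - b ≈ a * b
    -*- a b = trans (sym (-‿distribˡ-* a (- b))) (trans (-‿cong (sym (-‿distribʳ-* a b))) (-‿involutive (a * b)))

    δ⁺-inverse : IsInverse z⁺ δ⁺
    δ⁺-inverse = record { diagonal = diag ; inverse = inv }
      where
      diag : ∀ i → δ⁺ i i ≈ 1#
      diag zero    = refl
      diag (suc i) = IsInverse.diagonal δ-inverse i
      inv : ∀ {i j} → i ≢ j → (z⁺ i - z⁺ j) * δ⁺ i j ≈ 1#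
      inv {zero}  {zero}  i≢j = contradiction ≡.refl i≢j
      inv {zero}  {suc j} _   = trans (*-congʳ (0-‿ (z j))) (trans (-*- (z j) (z⁻¹ j)) (z-inverse j))
      inv {suc i} {zero}  _   = trans (*-congʳ (trans (+-congˡ -0#≈0#) (+-identityʳ (z i)))) (z-inverse i)
      inv {suc i} {suc j} i≢j = inverse δ-inverse (i≢j ∘ ≡.cong suc)

    zero-term : f zero * Prod.sum (δ⁺ zero) ≈ t ^ m
    zero-term = begin
      f zero * (1# * Prod.sum (λ k → - z⁻¹ k))          ≈⟨ *-congˡ (*-identityˡ _) ⟩
      f zero * Prod.sum (λ k → - z⁻¹ k)                 ≈⟨ Prod.∑-distrib-+ (λ k → 0# - t * z k) (λ k → - z⁻¹ k) ⟨
      Prod.sum (λ k → (0# - t * z k) * - z⁻¹ k)         ≈⟨ Prod.sum-cong-≋ (λ k → trans (*-congʳ (0-‿ _)) (trans (-*- (t * z k) (z⁻¹ k)) (trans (*-assoc _ _ _) (trans (*-congˡ (z-inverse k)) (*-identityʳ t))))) ⟩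
      Prod.sum {m} (λ _ → t)                            ≈⟨ Prod.sum-replicate m ⟩
      t ^ m                                          ∎

    numerator : ∀ {j k} → j ≢ k → (z j - t * z k) * δ j k ≈ r j k
    numerator {j} {k} j≢k = begin
      (z j - t * z k) * δ j k        ≈⟨ *-congʳ (ratio j≢k) ⟨
      r j k * (z j - z k) * δ j k    ≈⟨ *-assoc _ _ _ ⟩
      r j k * ((z j - z k) * δ j k)  ≈⟨ trans (*-congˡ (inverse δ-inverse j≢k)) (*-identityʳ _) ⟩
      r j k                          ∎

    -- The two products agree factor by factor except at k = j, where the left one has z j - t z j =
    -- (1 - t) z j and the right one has r j j = 1.
    x-product : ∀ j → Prod.sum (λ k → (z j - t * z k) * δ j k) ≈ (1# - t) * z j * Prod.sum (r j)
    x-product j = remove-common j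
      (trans (*-congˡ (IsInverse.diagonal δ-inverse j)) (trans (*-identityʳ _) (sym ([1-t]* (z j)))))
      (diagonal j) (λ k j≢k → numerator j≢k)
      where
      remove-common : ∀ {m} (j : Fin m) {a b : Fin m → Carrier} {u} →
                      a j ≈ u → b j ≈ 1# → (∀ k → j ≢ k → a k ≈ b k) → Prod.sum a ≈ u * Prod.sum b
      remove-common {suc m} j {a} {b} {u} aj bj e = begin
        Prod.sum a                            ≈⟨ Prod.sum-remove {i = j} a ⟩
        a j * Prod.sum (a ∘ punchIn j)        ≈⟨ *-cong aj (Prod.sum-cong-≋ λ k → e (punchIn j k) (Fin.punchInᵢ≢i j k ∘ ≡.sym)) ⟩
        u * Prod.sum (b ∘ punchIn j)          ≈⟨ *-congˡ (trans (*-congʳ bj) (*-identityˡ _)) ⟨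
        u * (b j * Prod.sum (b ∘ punchIn j))  ≈⟨ *-congˡ (Prod.sum-remove {i = j} b) ⟨
        u * Prod.sum b                        ∎

    x-term : ∀ j → f (suc j) * Prod.sum (δ⁺ (suc j)) ≈ (1# - t) * Prod.sum (r j)
    x-term j = begin
      f (suc j) * (z⁻¹ j * Prod.sum (δ j))                       ≈⟨ x∙yz≈y∙xz _ _ _ ⟩
      z⁻¹ j * (f (suc j) * Prod.sum (δ j))                       ≈⟨ *-congˡ (Prod.∑-distrib-+ (λ k → z j - t * z k) (δ j)) ⟨
      z⁻¹ j * Prod.sum (λ k → (z j - t * z k) * δ j k)           ≈⟨ *-congˡ (x-product j) ⟩
      z⁻¹ j * ((1# - t) * z j * Prod.sum (r j))                  ≈⟨ trans (sym (*-assoc _ _ _)) (*-congʳ (trans (x∙yz≈y∙xz _ _ _) (*-congˡ (trans (*-comm _ _) (z-inverse j))))) ⟩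
      (1# - t) * 1# * Prod.sum (r j)                             ≈⟨ *-congʳ (*-identityʳ _) ⟩
      (1# - t) * Prod.sum (r j)                                  ∎

-- Stabilizers of dominant vectors.

Stabilizes : ∀ {n} → Vector ℤ n → Permutation′ n → Set
Stabilizes lam v = ∀ i → (v • lam) i ≡ lam i

stabilizes? : ∀ {n} (lam : Vector ℤ n) → Decidable (Stabilizes lam)
stabilizes? lam v = Fin.all? λ i → (v • lam) i ℤ.≟ lam i

stabilizes-ʳ : ∀ {n} {lam : Vector ℤ n} v → Stabilizes lam v → ∀ i → lam (v ⟨$⟩ʳ i) ≡ lam i
stabilizes-ʳ {lam = lam} v st i = ≡.trans (≡.sym (st (v ⟨$⟩ʳ i))) (≡.cong lam (Perm.inverseˡ v))

dominant-tail : ∀ {n} {lam : Vector ℤ (suc n)} → Dominant lam → Dominant (lam ∘ suc)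
dominant-tail dom i j i≤j = dom (suc i) (suc j) (s≤s i≤j)

dominant-between : ∀ {n} {lam : Vector ℤ n} → Dominant lam → ∀ {i j k} → i Fin.≤ j → j Fin.≤ k →
                   lam i ≡ lam k → lam i ≡ lam j
dominant-between dom i≤j j≤k e = ℤ.≤-antisym (ℤ.≤-trans (ℤ.≤-reflexive e) (dom _ _ j≤k)) (dom _ _ i≤j)

-- Deleting any position of the first block gives the same vector as deleting position 0: before j
-- all entries involved equal λ_0, and from j on `punchIn j` is `suc`.
dominant-punchIn : ∀ {n} {lam : Vector ℤ (suc n)} → Dominant lam → ∀ {j} → lam zero ≡ lam j →
                   ∀ k → lam (punchIn j k) ≡ lam (suc k)
dominant-punchIn dom {zero}  e k       = ≡.refl
dominant-punchIn dom {suc j} e zero    = dominant-between dom {k = suc j} z≤n (s≤s z≤n) e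
dominant-punchIn dom {suc j} e (suc k) = dominant-punchIn (dominant-tail dom)
  (≡.trans (≡.sym (dominant-between dom {k = suc j} z≤n (s≤s z≤n) e)) e) k

-- The first entry is not counted: the block of entries equal to it has size `suc len`.
record InitialRun {n} (lam : Vector ℤ (suc n)) : Set where
  field
    len     : ℕ
    len≤n   : len ℕ.≤ n
    inside  : ∀ k → toℕ k ℕ.< len → lam zero ≡ lam (suc k)
    outside : ∀ k → len ℕ.≤ toℕ k → lam zero ≢ lam (suc k)

  inside⁺ : ∀ k → toℕ k ℕ.< suc len → lam zero ≡ lam k
  inside⁺ zero    _         = ≡.refl
  inside⁺ (suc k) (s≤s k<l) = inside k k<l

  outside⁺ : ∀ k → suc len ℕ.≤ toℕ k → lam zero ≢ lam k
  outside⁺ (suc k) (s≤s l≤k) = outside k l≤k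

initialRun : ∀ {n} {lam : Vector ℤ (suc n)} → Dominant lam → InitialRun lam
initialRun {zero}        dom = record { len = 0 ; len≤n = z≤n ; inside = λ _ () ; outside = λ () }
initialRun {suc n} {lam} dom with lam zero ℤ.≟ lam (suc zero)
... | no λ₀≢λ₁  = record { len = 0 ; len≤n = z≤n ; inside = λ _ ()
                         ; outside = λ k _ e → λ₀≢λ₁ (dominant-between dom {k = suc k} z≤n (s≤s z≤n) e) }
... | yes λ₀≡λ₁ = record
  { len = suc len ; len≤n = s≤s len≤n
  ; inside  = λ { zero _ → λ₀≡λ₁ ; (suc k) (s≤s k<l) → ≡.trans λ₀≡λ₁ (inside k k<l) }
  ; outside = λ { (suc k) (s≤s l≤k) e → outside k l≤k (≡.trans (≡.sym λ₀≡λ₁) e) } }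
  where open InitialRun (initialRun (dominant-tail dom))

insert-ˡ-at : ∀ {n} j (ρ : Permutation′ n) → Perm.insert zero j ρ ⟨$⟩ˡ j ≡ zero
insert-ˡ-at j ρ = Perm.inverseˡ (Perm.insert zero j ρ)

insert-ˡ-punchIn : ∀ {n} j (ρ : Permutation′ n) k → Perm.insert zero j ρ ⟨$⟩ˡ punchIn j k ≡ suc (ρ ⟨$⟩ˡ k)
insert-ˡ-punchIn j ρ k = ≡.trans
  (≡.cong (λ l → Perm.insert zero j ρ ⟨$⟩ˡ punchIn j l) (≡.sym (Perm.inverseʳ ρ)))
  (Perm.inverseˡ (Perm.insert zero j ρ))

-- Position j receives the entry λ_0, which gives the first condition. The rest compares λ without
-- position 0 with λ without position j; by `dominant-punchIn` these coincide, so the condition on ρ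
-- does not involve j.
stabilizes-insert : ∀ {n} {lam : Vector ℤ (suc n)} → Dominant lam → ∀ j ρ →
                    Stabilizes lam (Perm.insert zero j ρ) ⇔ (lam zero ≡ lam j × Stabilizes (lam ∘ suc) ρ)
stabilizes-insert {lam = lam} dom j ρ = mk⇔ to from
  where
  to : Stabilizes lam (Perm.insert zero j ρ) → lam zero ≡ lam j × Stabilizes (lam ∘ suc) ρ
  to st = λ₀≡λⱼ , λ k → ≡.trans (≡.cong lam (≡.sym (insert-ˡ-punchIn j ρ k)))
                        (≡.trans (st (punchIn j k)) (dominant-punchIn dom λ₀≡λⱼ k))
    where
    λ₀≡λⱼ : lam zero ≡ lam j
    λ₀≡λⱼ = ≡.trans (≡.cong lam (≡.sym (insert-ˡ-at j ρ))) (st j)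

  from : lam zero ≡ lam j × Stabilizes (lam ∘ suc) ρ → Stabilizes lam (Perm.insert zero j ρ)
  from (λ₀≡λⱼ , st) i with j Fin.≟ i
  ... | yes ≡.refl = λ₀≡λⱼ
  ... | no j≢i     = ≡.trans (st _) (≡.trans (≡.sym (dominant-punchIn dom λ₀≡λⱼ _)) (≡.cong lam (Fin.punchIn-punchOut j≢i)))

-- Sums over the stabilizer and over pairs of equal entries.

module StabilizerSums {c ℓ′} (M : CommutativeMonoid c ℓ′) where

  open CommutativeMonoid M
  open FiniteSums M

  []·-∑ : ∀ {a} {A : Set a} b (xs : List A) f → [ b ]· ∑ xs f ≈ ∑ xs λ x → [ b ]· f x
  []·-∑ true  xs       f = refl
  []·-∑ false []       f = refl
  []·-∑ false (_ ∷ xs) f = sym (trans (identityˡ _) (sym ([]·-∑ false xs f)))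

  -- `S (suc n)` is built from the image j of 0 and a permutation ρ of the rest, and
  -- `stabilizes-insert` splits the membership test into one on j and one on ρ.
  ∑-stabilizer : ∀ {n} {lam : Vector ℤ (suc n)} → Dominant lam → ∀ f →
                 ∑ (stabilizer lam) f
                   ≈ sum λ j → [ does (lam zero ℤ.≟ lam j) ]· ∑ (stabilizer (lam ∘ suc)) (f ∘ Perm.insert zero j)
  ∑-stabilizer {n} {lam} dom f = begin
    ∑ (stabilizer lam) f
      ≈⟨ ∑-filter (stabilizes? lam) (S (suc n)) f ⟩
    ∑ (S (suc n)) g
      ≈⟨ ∑-concatMap (λ j → map (Perm.insert zero j) (S n)) (allFin (suc n)) g ⟩
    ∑ (allFin (suc n)) (λ j → ∑ (map (Perm.insert zero j) (S n)) g)
      ≈⟨ ∑-allFin (suc n) _ ⟩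
    sum (λ j → ∑ (map (Perm.insert zero j) (S n)) g)
      ≈⟨ sum-cong-≋ (λ j → trans (∑-map (Perm.insert zero j) (S n) g) (factor-out j)) ⟩
    sum (λ j → [ does (lam zero ℤ.≟ lam j) ]· ∑ (stabilizer (lam ∘ suc)) (f ∘ Perm.insert zero j)) ∎
    where
    open SetoidReasoning setoid
    g : Permutation′ (suc n) → Carrier
    g w = [ does (stabilizes? lam w) ]· f w

    factor-out : ∀ j → ∑ (S n) (g ∘ Perm.insert zero j)
                         ≈ [ does (lam zero ℤ.≟ lam j) ]· ∑ (stabilizer (lam ∘ suc)) (f ∘ Perm.insert zero j)
    factor-out j = begin
      ∑ (S n) (g ∘ Perm.insert zero j)
        ≈⟨ ∑-cong (S n) (λ ρ → trans
             ([]·-cong (does-⇔ (stabilizes-insert dom j ρ) (stabilizes? lam (Perm.insert zero j ρ))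
                               ((lam zero ℤ.≟ lam j) ×-dec stabilizes? (lam ∘ suc) ρ)) refl)
             ([]·-∧ (does (lam zero ℤ.≟ lam j)) (does (stabilizes? (lam ∘ suc) ρ)) _)) ⟩
      ∑ (S n) (λ ρ → [ does (lam zero ℤ.≟ lam j) ]· [ does (stabilizes? (lam ∘ suc) ρ) ]· f (Perm.insert zero j ρ))
        ≈⟨ []·-∑ (does (lam zero ℤ.≟ lam j)) (S n) _ ⟨
      [ does (lam zero ℤ.≟ lam j) ]· ∑ (S n) (λ ρ → [ does (stabilizes? (lam ∘ suc) ρ) ]· f (Perm.insert zero j ρ))
        ≈⟨ []·-cong {does (lam zero ℤ.≟ lam j)} ≡.refl (∑-filter (stabilizes? (lam ∘ suc)) (S n) (f ∘ Perm.insert zero j)) ⟨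
      [ does (lam zero ℤ.≟ lam j) ]· ∑ (stabilizer (lam ∘ suc)) (f ∘ Perm.insert zero j) ∎

  ∑-stabilizer-cong : ∀ {n} (lam : Vector ℤ n) {f g} → (∀ w → Stabilizes lam w → f w ≈ g w) →
                      ∑ (stabilizer lam) f ≈ ∑ (stabilizer lam) g
  ∑-stabilizer-cong {n} lam {f} {g} e = trans (∑-filter (stabilizes? lam) (S n) f)
    (trans (∑-cong (S n) λ w → []·-cong-does (stabilizes? lam w) (e w)) (sym (∑-filter (stabilizes? lam) (S n) g)))

  -- Over the multiplicative monoid this is the product over the pairs i < j with λ_i = λ_j.
  sum-pairs : ∀ {n} → Vector ℤ n → (Fin n → Fin n → Carrier) → Carrier
  sum-pairs lam g = sum λ i → sum λ j → [ does (i Fin.<? j) ∧ does (lam i ℤ.≟ lam j) ]· g i j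

  sum-pairs-suc : ∀ {n} (lam : Vector ℤ (suc n)) g →
                  sum-pairs lam g ≈ sum (λ k → [ does (lam zero ℤ.≟ lam (suc k)) ]· g zero (suc k))
                                      ∙ sum-pairs (lam ∘ suc) (λ i j → g (suc i) (suc j))
  sum-pairs-suc {n} lam g = ∙-cong (identityˡ _) (sum-cong-≋ {n} λ i → identityˡ _)

  sum-pairs-∙ : ∀ {n} (lam : Vector ℤ n) g h →
                sum-pairs lam (λ i j → g i j ∙ h i j) ≈ sum-pairs lam g ∙ sum-pairs lam h
  sum-pairs-∙ {n} lam g h = trans
    (sum-cong-≋ {n} λ i → trans (sum-cong-≋ {n} λ j → []·-∙ (does (i Fin.<? j) ∧ does (lam i ℤ.≟ lam j)) (g i j) (h i j))
                            (∑-distrib-+ {n} _ _))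
    (∑-distrib-+ {n} _ _)

  sum-pairs-cong : ∀ {n} (lam : Vector ℤ n) {g h} → (∀ i j → i Fin.< j → g i j ≈ h i j) →
                   sum-pairs lam g ≈ sum-pairs lam h
  sum-pairs-cong lam {g} {h} e = sum-cong-≋ λ i → sum-cong-≋ λ j → aux i j (lam i ℤ.≟ lam j)
    where
    aux : ∀ i j (λᵢ≟λⱼ : Dec (lam i ≡ lam j)) →
          [ does (i Fin.<? j) ∧ does λᵢ≟λⱼ ]· g i j ≈ [ does (i Fin.<? j) ∧ does λᵢ≟λⱼ ]· h i j
    aux i j λᵢ≟λⱼ = trans ([]·-∧ (does (i Fin.<? j)) (does λᵢ≟λⱼ) (g i j))
      (trans ([]·-cong-does (i Fin.<? j) λ i<j → []·-cong {does λᵢ≟λⱼ} ≡.refl (e i j i<j))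
      (sym ([]·-∧ (does (i Fin.<? j)) (does λᵢ≟λⱼ) (h i j))))

-- Lengths as numbers of inversions.

private
  module ℕΣ = FiniteSums ℕ.+-0-commutativeMonoid

length-filter-∑ : ∀ {a p} {A : Set a} {P : A → Set p} (P? : Decidable P) xs →
                  length (filter P? xs) ≡ ℕΣ.∑ xs λ x → ℕΣ.[ does (P? x) ]· 1
length-filter-∑ P? xs = ≡.trans (length-∑ (filter P? xs)) (ℕΣ.∑-filter P? xs λ _ → 1)
  where
  length-∑ : ∀ {a} {A : Set a} (ys : List A) → length ys ≡ ℕΣ.∑ ys λ _ → 1
  length-∑ []       = ≡.refl
  length-∑ (y ∷ ys) = ≡.cong suc (length-∑ ys)

length-filter-allFin : ∀ {n p} {P : Fin n → Set p} (P? : Decidable P) →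
                       length (filter P? (allFin n)) ≡ ℕΣ.sum λ i → ℕΣ.[ does (P? i) ]· 1
length-filter-allFin {n} P? = ≡.trans (length-filter-∑ P? (allFin n)) (ℕΣ.∑-allFin n _)

inversions : ∀ {n} → Permutation′ n → Fin n → Fin n → ℕ
inversions w i j = ℕΣ.[ does (i Fin.<? j) ∧ does (w ⟨$⟩ʳ j Fin.<? w ⟨$⟩ʳ i) ]· 1

ℓ-sum : ∀ {n} (w : Permutation′ n) → ℓ w ≡ ℕΣ.sum λ i → ℕΣ.sum λ j → inversions w i j
ℓ-sum {n} w = begin
  ℓ w
    ≡⟨ length-filter-∑ (λ (i , j) → (i Fin.<? j) ×-dec (w ⟨$⟩ʳ j Fin.<? w ⟨$⟩ʳ i)) (cartesianProduct (allFin n) (allFin n)) ⟩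
  ℕΣ.∑ (cartesianProduct (allFin n) (allFin n)) (λ (i , j) → inversions w i j)
    ≡⟨ ℕΣ.∑-cartesianProduct (allFin n) (allFin n) _ ⟩
  ℕΣ.∑ (allFin n) (λ i → ℕΣ.∑ (allFin n) (inversions w i))
    ≡⟨ ℕΣ.∑-allFin n _ ⟩
  ℕΣ.sum (λ i → ℕΣ.∑ (allFin n) (inversions w i))
    ≡⟨ ℕΣ.sum-cong-≋ (λ i → ℕΣ.∑-allFin n (inversions w i)) ⟩
  ℕΣ.sum (λ i → ℕΣ.sum λ j → inversions w i j) ∎
  where open ≡.≡-Reasoning

count-below : ∀ {n} (j : Fin (suc n)) → ℕΣ.sum (λ k → ℕΣ.[ does (punchIn j k Fin.<? j) ]· 1) ≡ toℕ j
count-below {n}     zero    = ℕΣ.sum-replicate-zero n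
count-below {suc n} (suc j) = ≡.cong suc (count-below j)

punchIn-< : ∀ {n} (j : Fin (suc n)) {a b} → punchIn j a Fin.< punchIn j b ⇔ a Fin.< b
punchIn-< j {a} {b} = mk⇔
  (λ lt → ℕ.≰⇒> λ b≤a → ℕ.<⇒≱ lt (Fin.punchIn-mono-≤ j b a b≤a))
  (λ lt → ℕ.≰⇒> λ b≤a → ℕ.<⇒≱ lt (Fin.punchIn-cancel-≤ j b a b≤a))

-- Position 0 forms an inversion with each position whose image lies below j; ρ only permutes these
-- images, so there are j of them. Since `punchIn j` preserves and reflects the order, the other
-- inversions are those of ρ.
ℓ-insert : ∀ {n} j (ρ : Permutation′ n) → ℓ (Perm.insert zero j ρ) ≡ toℕ j ℕ.+ ℓ ρ
ℓ-insert j ρ = begin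
  ℓ (Perm.insert zero j ρ)
    ≡⟨ ℓ-sum (Perm.insert zero j ρ) ⟩
  ℕΣ.sum (λ k → ℕΣ.[ does (punchIn j (ρ ⟨$⟩ʳ k) Fin.<? j) ]· 1)
    ℕ.+ ℕΣ.sum (λ i → ℕΣ.sum λ k → inversions (Perm.insert zero j ρ) (suc i) (suc k))
    ≡⟨ ≡.cong₂ ℕ._+_ (≡.trans (≡.sym (ℕΣ.sum-permute (λ k → ℕΣ.[ does (punchIn j k Fin.<? j) ]· 1) ρ)) (count-below j))
         (ℕΣ.sum-cong-≋ λ i → ℕΣ.sum-cong-≋ λ k → ≡.cong (λ b → ℕΣ.[ does (i Fin.<? k) ∧ b ]· 1)
           (does-⇔ (punchIn-< j) (punchIn j (ρ ⟨$⟩ʳ k) Fin.<? punchIn j (ρ ⟨$⟩ʳ i)) (ρ ⟨$⟩ʳ k Fin.<? ρ ⟨$⟩ʳ i))) ⟩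
  toℕ j ℕ.+ ℕΣ.sum (λ i → ℕΣ.sum λ k → inversions ρ i k)
    ≡⟨ ≡.cong (toℕ j ℕ.+_) (ℓ-sum ρ) ⟨
  toℕ j ℕ.+ ℓ ρ ∎
  where open ≡.≡-Reasoning

-- The length of the longest element.

ℓ-id : ∀ n → ℓ (Perm.id {n}) ≡ 0
ℓ-id n = ≡.cong length (List.filter-none (λ (i , j) → (i Fin.<? j) ×-dec (j Fin.<? i))
  (All.universal (λ (i , j) (i<j , j<i) → ℕ.<-asym i<j j<i) (cartesianProduct (allFin n) (allFin n))))

-- Counts the pairs i < j with λ_i = λ_j by their first member: position 0 has `len` partners.
maxLength : ∀ {n} {lam : Vector ℤ n} → Dominant lam → ℕ
maxLength {zero}  dom = 0
maxLength {suc n} dom = InitialRun.len (initialRun dom) ℕ.+ maxLength (dominant-tail dom)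

∈-S⁻ : ∀ {n} {w : Permutation′ (suc n)} → w ∈ S (suc n) → ∃ λ j → ∃ λ ρ → ρ ∈ S n × w ≡ Perm.insert zero j ρ
∈-S⁻ {n} w∈S with j , w∈map ← Any.satisfied (Mem.∈-concatMap⁻ (λ j → map (Perm.insert zero j) (S n)) {xs = allFin (suc n)} w∈S)
  = j , Mem.∈-map⁻ (Perm.insert zero j) w∈map

∈-S⁺ : ∀ {n} j {ρ : Permutation′ n} → ρ ∈ S n → Perm.insert zero j ρ ∈ S (suc n)
∈-S⁺ {n} j ρ∈S = Mem.∈-concatMap⁺ (λ j → map (Perm.insert zero j) (S n)) {xs = allFin (suc n)}
  (Any.map (λ { ≡.refl → Mem.∈-map⁺ (Perm.insert zero j) ρ∈S }) (Mem.∈-allFin j))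

ℓ≤maxLength : ∀ {n} {lam : Vector ℤ n} (dom : Dominant lam) {w} → w ∈ S n → Stabilizes lam w → ℓ w ℕ.≤ maxLength dom
ℓ≤maxLength {zero}        dom (here ≡.refl) _ = ℕ.≤-refl
ℓ≤maxLength {suc n} {lam} dom w∈S st with ∈-S⁻ w∈S
... | j , ρ , ρ∈S , ≡.refl with λ₀≡λⱼ , st′ ← Equivalence.to (stabilizes-insert dom j ρ) st
  = ℕ.≤-trans (ℕ.≤-reflexive (ℓ-insert j ρ)) (ℕ.+-mono-≤ j≤len (ℓ≤maxLength (dominant-tail dom) ρ∈S st′))
  where
  open InitialRun (initialRun dom)
  j≤len : toℕ j ℕ.≤ len
  j≤len = ℕ.≮⇒≥ λ len<j → outside⁺ j len<j λ₀≡λⱼ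

-- The witness reverses every block: position 0 goes to `len`, the last position of its block, and
-- the remaining positions are treated recursively.
maxLength-attained : ∀ {n} {lam : Vector ℤ n} (dom : Dominant lam) →
                     ∃ λ w → w ∈ stabilizer lam × ℓ w ≡ maxLength dom
maxLength-attained {zero} {lam} dom = Perm.id , Mem.∈-filter⁺ (stabilizes? lam) {xs = S 0} (here ≡.refl) (λ ()) , ≡.refl
maxLength-attained {suc n} {lam} dom with ρ , ρ∈ , ℓρ ← maxLength-attained (dominant-tail dom)
  with ρ∈S , st ← Mem.∈-filter⁻ (stabilizes? (lam ∘ suc)) {xs = S n} ρ∈
  = Perm.insert zero j ρ
  , Mem.∈-filter⁺ (stabilizes? lam) (∈-S⁺ j ρ∈S) (Equivalence.from (stabilizes-insert dom j ρ) (inside⁺ j (s≤s (ℕ.≤-reflexive toℕ-j)) , st))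
  , ≡.trans (ℓ-insert j ρ) (≡.cong₂ ℕ._+_ toℕ-j ℓρ)
  where
  open InitialRun (initialRun dom)
  j : Fin (suc n)
  j = Fin.fromℕ< (s≤s len≤n)
  toℕ-j : toℕ j ≡ len
  toℕ-j = Fin.toℕ-fromℕ< (s≤s len≤n)

-- The bound has to cover the default ⊥ as well, since `argmax` may return it; for `longest` this is
-- the identity, of length 0.
f[argmax]≡ : ∀ {a} {A : Set a} (f : A → ℕ) ⊥ xs {m y} → f ⊥ ℕ.≤ m → (∀ {z} → z ∈ xs → f z ℕ.≤ m) →
             y ∈ xs → f y ≡ m → f (Extrema.argmax f ⊥ xs) ≡ m
f[argmax]≡ f ⊥ xs f⊥≤m f≤m y∈xs ≡.refl = ℕ.≤-antisym
  (Extrema.f[argmax]≤v⁺ f⊥≤m (All.tabulate f≤m))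
  (All.lookup (Extrema.f[xs]≤f[argmax] ⊥ xs) y∈xs)

∈-stabilizer⁻ : ∀ {n} (lam : Vector ℤ n) {w} → w ∈ stabilizer lam → w ∈ S n × Stabilizes lam w
∈-stabilizer⁻ {n} lam = Mem.∈-filter⁻ (stabilizes? lam) {xs = S n}

ℓ-longest : ∀ {n} {lam : Vector ℤ n} (dom : Dominant lam) → ℓ (longest lam) ≡ maxLength dom
ℓ-longest {n} {lam} dom = f[argmax]≡ ℓ Perm.id (stabilizer lam) (ℕ.≤-trans (ℕ.≤-reflexive (ℓ-id n)) z≤n) bound
  (proj₁ (proj₂ (maxLength-attained dom))) (proj₂ (proj₂ (maxLength-attained dom)))
  where
  bound : ∀ {w} → w ∈ stabilizer lam → ℓ w ℕ.≤ maxLength dom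
  bound w∈ = ℓ≤maxLength dom (proj₁ (∈-stabilizer⁻ lam w∈)) (proj₂ (∈-stabilizer⁻ lam w∈))

-- Multiplicities of the entries.

multiplicity-sum : ∀ {n} (lam : Vector ℤ n) a → multiplicity lam a ≡ ℕΣ.sum λ k → ℕΣ.[ does (lam k ℤ.≟ a) ]· 1
multiplicity-sum lam a = length-filter-allFin λ k → lam k ℤ.≟ a

multiplicity-head : ∀ {n} {lam : Vector ℤ (suc n)} → multiplicity lam (lam zero) ≡ suc (multiplicity (lam ∘ suc) (lam zero))
multiplicity-head {n} {lam} = begin
  multiplicity lam (lam zero)
    ≡⟨ multiplicity-sum lam (lam zero) ⟩
  ℕΣ.[ does (lam zero ℤ.≟ lam zero) ]· 1 ℕ.+ ℕΣ.sum (λ k → ℕΣ.[ does (lam (suc k) ℤ.≟ lam zero) ]· 1)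
    ≡⟨ ≡.cong₂ ℕ._+_ (ℕΣ.[]·-yes (lam zero ℤ.≟ lam zero) ≡.refl) (≡.sym (multiplicity-sum (lam ∘ suc) (lam zero))) ⟩
  suc (multiplicity (lam ∘ suc) (lam zero)) ∎
  where open ≡.≡-Reasoning

multiplicity-other : ∀ {n} {lam : Vector ℤ (suc n)} {a} → lam zero ≢ a → multiplicity lam a ≡ multiplicity (lam ∘ suc) a
multiplicity-other {n} {lam} {a} λ₀≢a = begin
  multiplicity lam a
    ≡⟨ multiplicity-sum lam a ⟩
  ℕΣ.[ does (lam zero ℤ.≟ a) ]· 1 ℕ.+ ℕΣ.sum (λ k → ℕΣ.[ does (lam (suc k) ℤ.≟ a) ]· 1)
    ≡⟨ ≡.cong₂ ℕ._+_ (ℕΣ.[]·-no (lam zero ℤ.≟ a) λ₀≢a) (≡.sym (multiplicity-sum (lam ∘ suc) a)) ⟩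
  multiplicity (lam ∘ suc) a ∎
  where open ≡.≡-Reasoning

multiplicity-tail : ∀ {n} {lam : Vector ℤ (suc n)} (run : InitialRun lam) →
                    multiplicity (lam ∘ suc) (lam zero) ≡ InitialRun.len run
multiplicity-tail {n} {lam} run = begin
  multiplicity (lam ∘ suc) (lam zero)
    ≡⟨ multiplicity-sum (lam ∘ suc) (lam zero) ⟩
  ℕΣ.sum (λ k → ℕΣ.[ does (lam (suc k) ℤ.≟ lam zero) ]· 1)
    ≡⟨ ℕΣ.sum-initial (λ k → lam (suc k) ℤ.≟ lam zero) len≤n (λ k → ≡.sym ∘ inside k) (λ k l≤k → outside k l≤k ∘ ≡.sym) (λ _ → 1) ⟩
  ℕΣ.sum {len} (λ _ → 1)
    ≡⟨ sum-1 len ⟩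
  len ∎
  where
  open ≡.≡-Reasoning
  open InitialRun run
  sum-1 : ∀ m → ℕΣ.sum {m} (λ _ → 1) ≡ m
  sum-1 zero    = ≡.refl
  sum-1 (suc m) = ≡.cong suc (sum-1 m)

-- The recursions for W_λ(t), the products and the symmetrized sum.

module StabilizerIdentities {c ℓ′} (F : CommutativeRing c ℓ′) (t : CommutativeRing.Carrier F)
  (cancel-1-t : Cancels1- F t) where

  open CommutativeRing F hiding (zero)
  open GeometricSums F t cancel-1-t
  open CommutativeSemigroupProperties *-commutativeSemigroup using (x∙yz≈y∙xz)
  open SetoidReasoning setoid
  open SemiringSum semiring using (*-distribʳ-sum)
  open Exp semiring using (_^_; ^-homo-*)
  private
    module Sum where
      open FiniteSums +-commutativeMonoid public
      open StabilizerSums +-commutativeMonoid public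
    module Prod where
      open FiniteSums *-commutativeMonoid public
      open StabilizerSums *-commutativeMonoid public

  *-distribˡ-∑ : ∀ {a} {A : Set a} u (xs : List A) f → u * Sum.∑ xs f ≈ Sum.∑ xs λ w → u * f w
  *-distribˡ-∑ u []       f = zeroʳ u
  *-distribˡ-∑ u (_ ∷ xs) f = trans (distribˡ u _ _) (+-congˡ (*-distribˡ-∑ u xs f))

  stabilizer-poincaré : ∀ {n} → Vector ℤ n → Carrier
  stabilizer-poincaré lam = Sum.∑ (stabilizer lam) λ w → t ^ ℓ w

  ∑-stabilizer-run : ∀ {n} {lam : Vector ℤ (suc n)} → Dominant lam → (run : InitialRun lam) → let open InitialRun run in ∀ f →
                     Sum.∑ (stabilizer lam) f
                       ≈ Sum.sum {suc len} λ i → Sum.∑ (stabilizer (lam ∘ suc)) (f ∘ Perm.insert zero (inject≤ i (s≤s len≤n)))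
  ∑-stabilizer-run {lam = lam} dom run f = trans (Sum.∑-stabilizer dom f)
    (Sum.sum-initial (λ j → lam zero ℤ.≟ lam j) (s≤s len≤n) inside⁺ outside⁺ λ j → Sum.∑ (stabilizer (lam ∘ suc)) (f ∘ Perm.insert zero j))
    where open InitialRun run

  poincaré-suc : ∀ {n} {lam : Vector ℤ (suc n)} → Dominant lam → (run : InitialRun lam) →
                 stabilizer-poincaré lam ≈ geometric (suc (InitialRun.len run)) * stabilizer-poincaré (lam ∘ suc)
  poincaré-suc {lam = lam} dom run = begin
    stabilizer-poincaré lam
      ≈⟨ ∑-stabilizer-run dom run (λ w → t ^ ℓ w) ⟩
    Sum.sum {suc len} (λ i → Sum.∑ (stabilizer (lam ∘ suc)) λ ρ → t ^ ℓ (Perm.insert zero (inject≤ i (s≤s len≤n)) ρ))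
      ≈⟨ Sum.sum-cong-≋ {suc len} (λ i → trans (Sum.∑-cong (stabilizer (lam ∘ suc)) (term i))
           (sym (*-distribˡ-∑ (t ^ toℕ i) (stabilizer (lam ∘ suc)) λ w → t ^ ℓ w))) ⟩
    Sum.sum {suc len} (λ i → t ^ toℕ i * stabilizer-poincaré (lam ∘ suc))
      ≈⟨ *-distribʳ-sum {suc len} (stabilizer-poincaré (lam ∘ suc)) (λ i → t ^ toℕ i) ⟨
    geometric (suc len) * stabilizer-poincaré (lam ∘ suc) ∎
    where
    open InitialRun run
    term : ∀ i ρ → t ^ ℓ (Perm.insert zero (inject≤ i (s≤s len≤n)) ρ) ≈ t ^ toℕ i * t ^ ℓ ρ
    term i ρ = begin
      t ^ ℓ (Perm.insert zero (inject≤ i (s≤s len≤n)) ρ)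
        ≡⟨ ≡.cong (t ^_) (≡.trans (ℓ-insert (inject≤ i (s≤s len≤n)) ρ) (≡.cong (ℕ._+ ℓ ρ) (Fin.toℕ-inject≤ i (s≤s len≤n)))) ⟩
      t ^ (toℕ i ℕ.+ ℓ ρ)
        ≈⟨ ^-homo-* t (toℕ i) (ℓ ρ) ⟩
      t ^ toℕ i * t ^ ℓ ρ ∎

  ∏-pairs-run : ∀ {n} {lam : Vector ℤ (suc n)} (run : InitialRun lam) g → let open InitialRun run in
                Prod.sum-pairs lam g ≈ Prod.sum (λ k → g zero (suc (inject≤ k len≤n)))
                                      * Prod.sum-pairs (lam ∘ suc) (λ i j → g (suc i) (suc j))
  ∏-pairs-run {lam = lam} run g = trans (Prod.sum-pairs-suc lam g)
    (*-congʳ (Prod.sum-initial (λ k → lam zero ℤ.≟ lam (suc k)) len≤n inside outside λ k → g zero (suc k)))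
    where open InitialRun run

  -- The pairs (0, k) contribute q 1 ⋯ q len, which is `geometric (suc len)`. The differences j - i
  -- are unchanged when both indices are shifted, so the other pairs form the same product for the
  -- tail.
  poincaré-pairs : ∀ {n} {lam : Vector ℤ n} → Dominant lam → (q : ℕ → Carrier) →
                   (∀ d → q (suc d) * (1# - t ^ suc d) ≈ 1# - t ^ suc (suc d)) →
                   stabilizer-poincaré lam ≈ Prod.sum-pairs lam λ i j → q (toℕ j ℕ.∸ toℕ i)
  poincaré-pairs {zero}        dom q q-ratio = +-identityʳ 1#
  poincaré-pairs {suc n} {lam} dom q q-ratio = begin
    stabilizer-poincaré lam
      ≈⟨ poincaré-suc dom run ⟩
    geometric (suc len) * stabilizer-poincaré (lam ∘ suc)
      ≈⟨ *-cong (sym (geometric-product len q q-ratio)) (poincaré-pairs (dominant-tail dom) q q-ratio) ⟩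
    Prod.sum {len} (λ k → q (suc (toℕ k))) * Prod.sum-pairs (lam ∘ suc) (λ i j → q (toℕ j ℕ.∸ toℕ i))
      ≈⟨ *-congʳ (Prod.sum-cong-≋ {len} λ k → reflexive (≡.cong (q ∘ suc) (≡.sym (Fin.toℕ-inject≤ k len≤n)))) ⟩
    Prod.sum {len} (λ k → q (suc (toℕ (inject≤ k len≤n)))) * Prod.sum-pairs (lam ∘ suc) (λ i j → q (toℕ j ℕ.∸ toℕ i))
      ≈⟨ ∏-pairs-run run (λ i j → q (toℕ j ℕ.∸ toℕ i)) ⟨
    Prod.sum-pairs lam (λ i j → q (toℕ j ℕ.∸ toℕ i)) ∎
    where
    run = initialRun dom
    open InitialRun run

  ∏-pairs-const : ∀ {n} {lam : Vector ℤ n} (dom : Dominant lam) a →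
                  Prod.sum-pairs lam (λ _ _ → a) ≈ a ^ maxLength dom
  ∏-pairs-const {zero}        dom a = refl
  ∏-pairs-const {suc n} {lam} dom a = begin
    Prod.sum-pairs lam (λ _ _ → a)
      ≈⟨ ∏-pairs-run (initialRun dom) (λ _ _ → a) ⟩
    Prod.sum {len} (λ _ → a) * Prod.sum-pairs (lam ∘ suc) (λ _ _ → a)
      ≈⟨ *-cong (Prod.sum-replicate len) (∏-pairs-const (dominant-tail dom) a) ⟩
    a ^ len * a ^ maxLength (dominant-tail dom)
      ≈⟨ ^-homo-* a len (maxLength (dominant-tail dom)) ⟨
    a ^ maxLength dom ∎
    where open InitialRun (initialRun dom)

  -- Given w = insert zero j ρ, the pairs (0, k) contribute ∏_{k≠j} r j k over the block of j,
  -- whatever ρ is, and the other pairs give the summand of ρ for the kernel without j.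
  sum-symmetrized : ∀ {n} {lam : Vector ℤ n} → Dominant lam → ∀ {r} → Kernel r →
                    Sum.∑ (stabilizer lam) (λ w → Prod.sum-pairs lam λ i k → r (w ⟨$⟩ʳ i) (w ⟨$⟩ʳ k)) ≈ stabilizer-poincaré lam
  sum-symmetrized {zero}        dom κ = refl
  sum-symmetrized {suc n} {lam} dom {r} κ = begin
    Sum.∑ (stabilizer lam) (λ w → Prod.sum-pairs lam λ i k → r (w ⟨$⟩ʳ i) (w ⟨$⟩ʳ k))
      ≈⟨ ∑-stabilizer-run dom run _ ⟩
    Sum.sum (λ i → Sum.∑ (stabilizer (lam ∘ suc)) λ ρ → symmetrand (Perm.insert zero (e i) ρ))
      ≈⟨ Sum.sum-cong-≋ block ⟩
    Sum.sum (λ i → Prod.sum (λ k → r (e i) (e k)) * stabilizer-poincaré (lam ∘ suc))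
      ≈⟨ *-distribʳ-sum (stabilizer-poincaré (lam ∘ suc)) (λ i → Prod.sum λ k → r (e i) (e k)) ⟨
    Sum.sum (λ i → Prod.sum (λ k → r (e i) (e k))) * stabilizer-poincaré (lam ∘ suc)
      ≈⟨ *-congʳ (sum-kernel (restrict e (Fin.inject≤-injective _ _ _ _) κ)) ⟩
    geometric (suc len) * stabilizer-poincaré (lam ∘ suc)
      ≈⟨ poincaré-suc dom run ⟨
    stabilizer-poincaré lam ∎
    where
    run = initialRun dom
    open InitialRun run
    e : Fin (suc len) → Fin (suc n)
    e i = inject≤ i (s≤s len≤n)

    symmetrand : Permutation′ (suc n) → Carrier
    symmetrand w = Prod.sum-pairs lam λ i k → r (w ⟨$⟩ʳ i) (w ⟨$⟩ʳ k)

    first-row : ∀ {j} → lam zero ≡ lam j → ∀ ρ → Stabilizes (lam ∘ suc) ρ →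
                Prod.sum (λ k → Prod.[ does (lam zero ℤ.≟ lam (suc k)) ]· r j (punchIn j (ρ ⟨$⟩ʳ k)))
                  ≈ Prod.sum λ k → r j (e k)
    first-row {j} λ₀≡λⱼ ρ st = begin
      Prod.sum (λ k → Prod.[ does (lam zero ℤ.≟ lam (suc k)) ]· r j (punchIn j (ρ ⟨$⟩ʳ k)))
        -- The test on position k is rewritten as a test on its image `punchIn j (ρ k)`, which
        -- carries the same entry; after that ρ can be removed by reindexing.
        ≡⟨ Prod.sum-cong-≗ (λ k → ≡.cong (λ b → Prod.[ does (lam zero ℤ.≟ b) ]· r j (punchIn j (ρ ⟨$⟩ʳ k)))
             (≡.trans (≡.sym (stabilizes-ʳ ρ st k)) (≡.sym (dominant-punchIn dom λ₀≡λⱼ (ρ ⟨$⟩ʳ k))))) ⟩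
      Prod.sum (λ k → row (punchIn j (ρ ⟨$⟩ʳ k)))
        ≈⟨ Prod.sum-permute (row ∘ punchIn j) ρ ⟨
      Prod.sum (row ∘ punchIn j)
        -- The missing factor k = j may be added because the kernel is 1 on the diagonal; the
        -- product then runs over the whole block.
        ≈⟨ trans (*-congʳ (trans (Prod.[]·-yes (lam zero ℤ.≟ lam j) λ₀≡λⱼ) (Kernel.diagonal κ j))) (*-identityˡ _) ⟨
      row j * Prod.sum (row ∘ punchIn j)
        ≈⟨ Prod.sum-remove {i = j} row ⟨
      Prod.sum row
        ≈⟨ Prod.sum-initial (λ k → lam zero ℤ.≟ lam k) (s≤s len≤n) inside⁺ outside⁺ (r j) ⟩
      Prod.sum (λ k → r j (e k)) ∎
      where
      row : Fin (suc n) → Carrier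
      row k = Prod.[ does (lam zero ℤ.≟ lam k) ]· r j k

    block : ∀ i → Sum.∑ (stabilizer (lam ∘ suc)) (λ ρ → symmetrand (Perm.insert zero (e i) ρ))
                    ≈ Prod.sum (λ k → r (e i) (e k)) * stabilizer-poincaré (lam ∘ suc)
    block i = begin
      Sum.∑ (stabilizer (lam ∘ suc)) (λ ρ → symmetrand (Perm.insert zero (e i) ρ))
        ≈⟨ Sum.∑-stabilizer-cong (lam ∘ suc) (λ ρ st → trans (Prod.sum-pairs-suc lam λ a b → r (Perm.insert zero (e i) ρ ⟨$⟩ʳ a) (Perm.insert zero (e i) ρ ⟨$⟩ʳ b)) (*-congʳ (first-row λ₀≡λₑ ρ st))) ⟩
      Sum.∑ (stabilizer (lam ∘ suc)) (λ ρ → Prod.sum (λ k → r (e i) (e k)) * tail-symmetrand ρ)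
        ≈⟨ *-distribˡ-∑ _ (stabilizer (lam ∘ suc)) tail-symmetrand ⟨
      Prod.sum (λ k → r (e i) (e k)) * Sum.∑ (stabilizer (lam ∘ suc)) tail-symmetrand
        -- The kernel without e i varies with i, but the value given by induction depends on the
        -- tail of λ alone.
        ≈⟨ *-congˡ (sum-symmetrized (dominant-tail dom) (restrict (punchIn (e i)) (Fin.punchIn-injective (e i) _ _) κ)) ⟩
      Prod.sum (λ k → r (e i) (e k)) * stabilizer-poincaré (lam ∘ suc) ∎
      where
      tail-symmetrand : Permutation′ n → Carrier
      tail-symmetrand ρ = Prod.sum-pairs (lam ∘ suc) λ a b → r (punchIn (e i) (ρ ⟨$⟩ʳ a)) (punchIn (e i) (ρ ⟨$⟩ʳ b))
      λ₀≡λₑ : lam zero ≡ lam (e i)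
      λ₀≡λₑ = inside⁺ (e i) (ℕ.≤-trans (s≤s (ℕ.≤-reflexive (Fin.toℕ-inject≤ i (s≤s len≤n)))) (Fin.toℕ<n i))

  -- Uniqueness ensures that y is met once, so u is picked up exactly once.
  ∏-update : ∀ {a} {A : Set a} {xs : List A} {y} → Unique xs → y ∈ xs → ∀ {f g : A → Carrier} {u} →
             g y ≈ u * f y → (∀ z → y ≢ z → g z ≈ f z) → Prod.∑ xs g ≈ u * Prod.∑ xs f
  ∏-update {xs = z ∷ xs} (z∉xs ∷ _) (here ≡.refl) {f} {g} gy g≈f =
    trans (*-cong gy (agree z∉xs)) (*-assoc _ _ _)
    where
    agree : ∀ {ys} → All (z ≢_) ys → Prod.∑ ys g ≈ Prod.∑ ys f
    agree []         = refl
    agree (z≢w ∷ z∉) = *-cong (g≈f _ z≢w) (agree z∉)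
  ∏-update {xs = z ∷ xs} (z∉xs ∷ uniq) (there y∈xs) {f} {g} gy g≈f = trans
    (*-cong (g≈f z λ { ≡.refl → All.lookup z∉xs y∈xs ≡.refl }) (∏-update uniq y∈xs gy g≈f))
    (x∙yz≈y∙xz _ _ _)

  -- The list xs only has to contain the entries of λ, so it can stay fixed while λ shrinks: values
  -- that no longer occur contribute `factorial 0`. Passing to the tail lowers a single
  -- multiplicity, that of λ_0, from `suc len` to `len`.
  poincaré-multiplicities : ∀ {n} {lam : Vector ℤ n} → Dominant lam → (factorial : ℕ → Carrier) → factorial 0 ≈ 1# →
                            (∀ m → factorial (suc m) ≈ geometric (suc m) * factorial m) →
                            ∀ {xs} → Unique xs → (∀ i → lam i ∈ xs) →
                            stabilizer-poincaré lam ≈ Prod.∑ xs (factorial ∘ multiplicity lam)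
  poincaré-multiplicities {zero}        dom _ factorial-0 _ {xs} _ _ = trans (+-identityʳ 1#) (sym (ones xs))
    where
    ones : ∀ xs → Prod.∑ xs _ ≈ 1#
    ones []       = refl
    ones (_ ∷ xs) = trans (*-cong factorial-0 (ones xs)) (*-identityˡ 1#)
  poincaré-multiplicities {suc n} {lam} dom factorial factorial-0 factorial-suc {xs} uniq lam∈xs = begin
    stabilizer-poincaré lam
      ≈⟨ poincaré-suc dom run ⟩
    geometric (suc len) * stabilizer-poincaré (lam ∘ suc)
      ≈⟨ *-congˡ (poincaré-multiplicities (dominant-tail dom) factorial factorial-0 factorial-suc uniq (lam∈xs ∘ suc)) ⟩
    geometric (suc len) * Prod.∑ xs (factorial ∘ multiplicity (lam ∘ suc))
      ≈⟨ ∏-update uniq (lam∈xs zero)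
           (trans (reflexive (≡.cong factorial (multiplicity-head {lam = lam})))
             (trans (factorial-suc _) (*-congʳ (reflexive (≡.cong (geometric ∘ suc) (multiplicity-tail run))))))
           (λ a λ₀≢a → reflexive (≡.cong factorial (multiplicity-other {lam = lam} λ₀≢a))) ⟨
    Prod.∑ xs (factorial ∘ multiplicity lam) ∎
    where
    run = initialRun dom
    open InitialRun run

-- Cancellation in the ring of fractions.

module FractionProperties {c ℓ} (R : CommutativeRing c ℓ) where

  open Fractions R
  private
    module R = CommutativeRing R
    module F = CommutativeRing fractionRing
  open Solver R.commutativeSemiring using (solve; _:=_; _:*_)
  open SetoidReasoning F.setoid

  opaque
    unfolding _*ᶠ_

    nonZero-* : ∀ {f g} → NonZero f → NonZero g → NonZero (f *ᶠ g)
    nonZero-* = regular-*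

    nonZero-factorˡ : ∀ {f g} → NonZero (f *ᶠ g) → NonZero f
    nonZero-factorˡ = regular-factorˡ

    -- Multiplication of fractions is opaque, so the evaluation of a product at a point needs its
    -- numerator and denominator as explicit equations.
    num-* : ∀ f g → num (f *ᶠ g) ≡ num f R.* num g
    num-* f g = ≡.refl

    den-* : ∀ f g → den (f *ᶠ g) ≡ den f R.* den g
    den-* f g = ≡.refl

    ÷-*-cancel : ∀ f g {nz} → f ÷ g [ nz ] *ᶠ g ≃ f
    ÷-*-cancel (a / b [ _ ]) (c / d [ _ ]) = *≡* (solve 4 (λ a b c d → (a :* d :* c :* b) := (a :* (b :* c :* d))) R.refl a b c d)

    *-den : ∀ f → f *ᶠ ι (den f) ≃ ι (num f)
    *-den (a / b [ _ ]) = *≡* (R.trans (R.*-identityʳ _) (R.*-congˡ (R.sym (R.*-identityʳ b))))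

  invertible⇒nonZero : ∀ {f g} → f *ᶠ g ≃ ι R.1# → NonZero f
  invertible⇒nonZero {f} {g} e = nonZero-factorˡ {f} {g} (nonZero-cong (≃-sym e) regular-1)

  *-cancelʳ-nonZero : ∀ {f g h} → NonZero h → f *ᶠ h ≃ g *ᶠ h → f ≃ g
  *-cancelʳ-nonZero {f} {g} {h} nz e = begin
    f                                   ≈⟨ expand f ⟩
    f *ᶠ h *ᶠ (ι R.1# ÷ h [ nz ])       ≈⟨ F.*-congʳ e ⟩
    g *ᶠ h *ᶠ (ι R.1# ÷ h [ nz ])       ≈⟨ expand g ⟨
    g                                   ∎
    where
    expand : ∀ k → k ≃ k *ᶠ h *ᶠ (ι R.1# ÷ h [ nz ])
    expand k = begin
      k                                   ≈⟨ F.*-identityʳ k ⟨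
      k *ᶠ ι R.1#                         ≈⟨ F.*-congˡ (F.trans (F.*-comm h (ι R.1# ÷ h [ nz ])) (÷-*-cancel (ι R.1#) h)) ⟨
      k *ᶠ (h *ᶠ (ι R.1# ÷ h [ nz ]))     ≈⟨ F.*-assoc k h _ ⟨
      k *ᶠ h *ᶠ (ι R.1# ÷ h [ nz ])       ∎

-- The kernel (u - t v)/(u - v) in two variables.

module RationalFunctionProperties {c ℓ′} (K : CommutativeRing c ℓ′) (n : ℕ) where

  open Polynomials K
  open RationalFunctions K n hiding (zero)
  private
    R = polyRing (Var n)
    module R = CommutativeRing R
    module ι = IsRingHomomorphism ι-isRingHomomorphism
  open FractionProperties R
  open RingProperties ring using (x[y-z]≈xy-xz; [y-z]x≈yx-zx)
  open CommutativeSemigroupProperties *-commutativeSemigroup using (x∙yz≈y∙xz; interchange)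
  open Exp semiring using (^-assocʳ)
  open SetoidReasoning setoid

  cancel-1-t : ∀ {a b} → (1# - t) * a ≈ (1# - t) * b → a ≈ b
  cancel-1-t e = *-cancelʳ-nonZero 1-t≠0 (trans (*-comm _ _) (trans e (*-comm _ _)))

  open GeometricSums fractionRing t cancel-1-t
  open StabilizerIdentities fractionRing t cancel-1-t
  private
    module Sum = FiniteSums +-commutativeMonoid
    module Prod where
      open FiniteSums *-commutativeMonoid public
      open StabilizerSums *-commutativeMonoid public

  gen-inverse : ∀ v → gen v * gen⁻¹ v ≈ 1#
  gen-inverse v = trans (*-comm _ _) (*-den (gen⁻¹ v))

  gen≠0 : ∀ v → NonZero (gen v)
  gen≠0 v = invertible⇒nonZero {gen v} {gen⁻¹ v} (gen-inverse v)

  gen*[1-gen⁻¹*] : ∀ u a → gen u * (1# - gen⁻¹ u * a) ≈ gen u - a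
  gen*[1-gen⁻¹*] u a = begin
    gen u * (1# - gen⁻¹ u * a)               ≈⟨ x[y-z]≈xy-xz _ _ _ ⟩
    gen u * 1# - gen u * (gen⁻¹ u * a)       ≈⟨ +-cong (*-identityʳ _) (-‿cong (trans (sym (*-assoc _ _ _)) (trans (*-congʳ (gen-inverse u)) (*-identityˡ a)))) ⟩
    gen u - a                                ∎

  gen-gen≠0 : ∀ {u v} → v ≢ u → NonZero (gen u - gen v)
  gen-gen≠0 {u} {v} v≢u = nonZero-cong (gen*[1-gen⁻¹*] u (gen v))
    (nonZero-* {gen u} {1# - gen⁻¹ u * gen v} (gen≠0 u) (1-u⁻¹v≠0 v≢u))

  -- Indexed by variables so that one kernel serves both c-functions: it is taken at (x_i, x_j) for
  -- c^X and at (Y_j, Y_i) for c^Y.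
  kernelAt : (u v : Var n) → Carrier
  kernelAt u v with v ≟ᵛ u
  ... | yes _  = 1#
  ... | no v≢u = (gen u - t * gen v) ÷ (gen u - gen v) [ gen-gen≠0 v≢u ]

  kernelAt-diagonal : ∀ u → kernelAt u u ≈ 1#
  kernelAt-diagonal u with u ≟ᵛ u
  ... | yes _  = refl
  ... | no u≢u = contradiction ≡.refl u≢u

  kernelAt-ratio : ∀ {u v} → v ≢ u → kernelAt u v * (gen u - gen v) ≈ gen u - t * gen v
  kernelAt-ratio {u} {v} v≢u with v ≟ᵛ u
  ... | yes v≡u = contradiction v≡u v≢u
  ... | no _    = ÷-*-cancel (gen u - t * gen v) (gen u - gen v)

  kernelAt-unique : ∀ {u v a f} → v ≢ u → f * (1# - gen⁻¹ u * gen v) ≈ a * (1# - t * (gen⁻¹ u * gen v)) → f ≈ a * kernelAt u v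
  kernelAt-unique {u} {v} {a} {f} v≢u e = *-cancelʳ-nonZero (gen-gen≠0 v≢u) (begin
    f * (gen u - gen v)                               ≈⟨ *-congˡ (gen*[1-gen⁻¹*] u (gen v)) ⟨
    f * (gen u * (1# - gen⁻¹ u * gen v))              ≈⟨ x∙yz≈y∙xz _ _ _ ⟩
    gen u * (f * (1# - gen⁻¹ u * gen v))              ≈⟨ *-congˡ e ⟩
    gen u * (a * (1# - t * (gen⁻¹ u * gen v)))        ≈⟨ x∙yz≈y∙xz _ _ _ ⟩
    a * (gen u * (1# - t * (gen⁻¹ u * gen v)))        ≈⟨ *-congˡ (*-congˡ (+-congˡ (-‿cong (x∙yz≈y∙xz _ _ _)))) ⟩
    a * (gen u * (1# - gen⁻¹ u * (t * gen v)))        ≈⟨ *-congˡ (gen*[1-gen⁻¹*] u (t * gen v)) ⟩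
    a * (gen u - t * gen v)                           ≈⟨ *-congˡ (kernelAt-ratio v≢u) ⟨
    a * (kernelAt u v * (gen u - gen v))              ≈⟨ *-assoc _ _ _ ⟨
    a * kernelAt u v * (gen u - gen v)                ∎)

  private
    x-injective : ∀ {i j : Fin n} → x i ≡ x j → i ≡ j
    x-injective ≡.refl = ≡.refl

  kernel-x : Kernel (λ i j → kernelAt (x i) (x j))
  kernel-x = record
    { z = gen ∘ x ; z⁻¹ = gen⁻¹ ∘ x ; z-inverse = gen-inverse ∘ x
    ; δ = λ i j → δ (x i) (x j)
    ; δ-inverse = record { diagonal = λ i → δ-diagonal (x i) ; inverse = λ i≢j → δ-inverse (i≢j ∘ ≡.sym ∘ x-injective) }
    ; diagonal = λ i → kernelAt-diagonal (x i)
    ; ratio = λ i≢j → kernelAt-ratio (i≢j ∘ ≡.sym ∘ x-injective) }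
    where
    δ : Var n → Var n → Carrier
    δ u v with v ≟ᵛ u
    ... | yes _  = 1#
    ... | no v≢u = 1# ÷ (gen u - gen v) [ gen-gen≠0 v≢u ]
    δ-diagonal : ∀ u → δ u u ≈ 1#
    δ-diagonal u with u ≟ᵛ u
    ... | yes _  = refl
    ... | no u≢u = contradiction ≡.refl u≢u
    δ-inverse : ∀ {u v} → v ≢ u → (gen u - gen v) * δ u v ≈ 1#
    δ-inverse {u} {v} v≢u with v ≟ᵛ u
    ... | yes v≡u = contradiction v≡u v≢u
    ... | no _    = trans (*-comm _ _) (÷-*-cancel 1# (gen u - gen v))

  -- Products over pairs as conditional products.

  ∏<-cong-pairs : ∀ (lam : Vector ℤ n) (f : ∀ i j → i Fin.< j → Carrier) (h : Fin n → Fin n → Carrier) →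
                  (∀ i j (i<j : i Fin.< j) → lam i ≡ lam j → f i j i<j ≈ h i j) →
                  (∀ i j → ¬ (i Fin.< j × lam i ≡ lam j) → 1# ≈ h i j) → ∏< lam f ≈ Prod.sum λ i → Prod.sum (h i)
  -- The left-hand side is the local function of ∏<; it has no name, so unification has to find it.
  ∏<-cong-factor : ∀ (lam : Vector ℤ n) (f : ∀ i j → i Fin.< j → Carrier) (h : Fin n → Fin n → Carrier) →
                   (∀ i j (i<j : i Fin.< j) → lam i ≡ lam j → f i j i<j ≈ h i j) →
                   (∀ i j → ¬ (i Fin.< j × lam i ≡ lam j) → 1# ≈ h i j) → ∀ i j → _ ≈ h i j
  ∏<-cong-pairs lam f h e e₁ = Prod.sum-cong-≋ {n} λ i → Prod.sum-cong-≋ {n} λ j → ∏<-cong-factor lam f h e e₁ i j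
  ∏<-cong-factor lam f h e e₁ i j with i Fin.<? j | lam i ℤ.≟ lam j
  ... | yes i<j | yes λᵢ≡λⱼ = e i j i<j λᵢ≡λⱼ
  ... | yes _   | no λᵢ≢λⱼ  = e₁ i j (λᵢ≢λⱼ ∘ proj₂)
  ... | no i≮j  | _         = e₁ i j (i≮j ∘ proj₁)

  ∏<-pairs : ∀ (lam : Vector ℤ n) {f} {g : Fin n → Fin n → Carrier} →
             (∀ i j (i<j : i Fin.< j) → f i j i<j ≈ g i j) → ∏< lam f ≈ Prod.sum-pairs lam g
  ∏<-pairs lam {f} {g} e = ∏<-cong-pairs lam f _
    (λ i j i<j λᵢ≡λⱼ → trans (e i j i<j) (sym (Prod.[]·-yes ((i Fin.<? j) ×-dec (lam i ℤ.≟ lam j)) (i<j , λᵢ≡λⱼ))))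
    (λ i j ¬p → sym (Prod.[]·-no ((i Fin.<? j) ×-dec (lam i ℤ.≟ lam j)) ¬p))

  -- The action of permutations on rational functions.

  opaque
    unfolding _*ᶠ_

    ·-homo-* : ∀ w f g → w · (f * g) ≈ (w · f) * (w · g)
    ·-homo-* w f g = *≡* R.refl

    ·-homo-+ : ∀ w f g → w · (f + g) ≈ (w · f) + (w · g)
    ·-homo-+ w f g = *≡* R.refl

    ·-homo-‿ : ∀ w f → w · (- f) ≈ - (w · f)
    ·-homo-‿ w f = *≡* R.refl

  ·-cong : ∀ w {f g} → f ≈ g → w · f ≈ w · g
  ·-cong w (*≡* e) = *≡* (substitute-cong (var ∘ permuteVar w) e)

  ·-1 : ∀ w → w · 1# ≈ 1#
  ·-1 w = *≡* R.refl

  ·-gen : ∀ w v → w · gen v ≈ gen (permuteVar w v)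
  ·-gen w v = *≡* R.refl

  ·-gen⁻¹ : ∀ w v → w · gen⁻¹ v ≈ gen⁻¹ (permuteVar w v)
  ·-gen⁻¹ w v = *≡* R.refl

  ·-sum : ∀ w {m} (f : Fin m → Carrier) → w · Prod.sum f ≈ Prod.sum λ i → w · f i
  ·-sum w {zero}  f = ·-1 w
  ·-sum w {suc m} f = trans (·-homo-* w _ _) (*-congˡ (·-sum w (f ∘ suc)))

  ·-[] : ∀ w b f → w · (Prod.[ b ]· f) ≈ Prod.[ b ]· (w · f)
  ·-[] w true  f = refl
  ·-[] w false f = ·-1 w

  ·-pairs : ∀ w (lam : Vector ℤ n) g → w · Prod.sum-pairs lam g ≈ Prod.sum-pairs lam λ i j → w · g i j
  ·-pairs w lam g = trans (·-sum w λ i → Prod.sum (entry i)) (Prod.sum-cong-≋ {n} λ i → trans (·-sum w (entry i)) (Prod.sum-cong-≋ {n} λ j →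
    ·-[] w (does (i Fin.<? j) ∧ does (lam i ℤ.≟ lam j)) (g i j)))
    where
    entry : Fin n → Fin n → Carrier
    entry i j = Prod.[ does (i Fin.<? j) ∧ does (lam i ℤ.≟ lam j) ]· g i j

  ·-t : ∀ w → w · t ≈ t
  ·-t w = trans (·-homo-* w _ _) (*-cong (·-gen w t½) (trans (·-homo-* w _ _) (*-cong (·-gen w t½) (·-1 w))))

  -- The kernel is determined by its product with u - v, a relation between ring elements to which w
  -- applies; injectivity of w keeps the new denominator nonzero.
  ·-kernelAt : ∀ w {i j} → i ≢ j → w · kernelAt (x i) (x j) ≈ kernelAt (x (w ⟨$⟩ʳ i)) (x (w ⟨$⟩ʳ j))
  ·-kernelAt w {i} {j} i≢j = *-cancelʳ-nonZero (gen-gen≠0 wj≢wi) (begin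
    (w · kernelAt (x i) (x j)) * (gen (x (w ⟨$⟩ʳ i)) - gen (x (w ⟨$⟩ʳ j)))
      ≈⟨ *-congˡ (trans (·-homo-+ w _ _) (+-cong (·-gen w (x i)) (trans (·-homo-‿ w _) (-‿cong (·-gen w (x j)))))) ⟨
    (w · kernelAt (x i) (x j)) * (w · (gen (x i) - gen (x j)))
      ≈⟨ ·-homo-* w _ _ ⟨
    w · (kernelAt (x i) (x j) * (gen (x i) - gen (x j)))
      ≈⟨ ·-cong w (kernelAt-ratio (i≢j ∘ ≡.sym ∘ x-injective)) ⟩
    w · (gen (x i) - t * gen (x j))
      ≈⟨ trans (·-homo-+ w _ _) (+-cong (·-gen w (x i)) (trans (·-homo-‿ w _) (-‿cong
           (trans (·-homo-* w _ _) (*-cong (·-t w) (·-gen w (x j))))))) ⟩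
    gen (x (w ⟨$⟩ʳ i)) - t * gen (x (w ⟨$⟩ʳ j))
      ≈⟨ kernelAt-ratio wj≢wi ⟨
    kernelAt (x (w ⟨$⟩ʳ i)) (x (w ⟨$⟩ʳ j)) * (gen (x (w ⟨$⟩ʳ i)) - gen (x (w ⟨$⟩ʳ j))) ∎)
    where
    wj≢wi : x (w ⟨$⟩ʳ j) ≢ x (w ⟨$⟩ʳ i)
    wj≢wi e = i≢j (≡.trans (≡.sym (Perm.inverseˡ w)) (≡.trans (≡.cong (w ⟨$⟩ˡ_) (≡.sym (x-injective e))) (Perm.inverseˡ w)))

  private
    <⇒≢ : ∀ {i j : Fin n} → i Fin.< j → i ≢ j
    <⇒≢ i<j ≡.refl = ℕ.<-irrefl ≡.refl i<j

  ·-∏< : ∀ w lam {f} a → w · a ≈ a → (∀ i j (i<j : i Fin.< j) → f i j i<j ≈ a * kernelAt (x i) (x j)) →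
         w · ∏< lam f ≈ Prod.sum-pairs lam (λ _ _ → a) * Prod.sum-pairs lam λ i j → kernelAt (x (w ⟨$⟩ʳ i)) (x (w ⟨$⟩ʳ j))
  ·-∏< w lam {f} a wa e = begin
    w · ∏< lam f
      ≈⟨ ·-cong w (∏<-pairs lam e) ⟩
    w · Prod.sum-pairs lam (λ i j → a * kernelAt (x i) (x j))
      ≈⟨ ·-pairs w lam _ ⟩
    Prod.sum-pairs lam (λ i j → w · (a * kernelAt (x i) (x j)))
      ≈⟨ Prod.sum-pairs-cong lam (λ i j i<j → trans (·-homo-* w _ _) (*-cong wa (·-kernelAt w (<⇒≢ i<j)))) ⟩
    Prod.sum-pairs lam (λ i j → a * kernelAt (x (w ⟨$⟩ʳ i)) (x (w ⟨$⟩ʳ j)))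
      ≈⟨ Prod.sum-pairs-∙ lam (λ _ _ → a) _ ⟩
    Prod.sum-pairs lam (λ _ _ → a) * Prod.sum-pairs lam (λ i j → kernelAt (x (w ⟨$⟩ʳ i)) (x (w ⟨$⟩ʳ j))) ∎

  -- The factors of the products in the theorem.

  factor-x : ∀ {i j} (i<j : i Fin.< j) →
             (1# - t * (gen⁻¹ (x i) * gen (x j))) ÷ (1# - gen⁻¹ (x i) * gen (x j)) [ 1-xᵢ⁻¹xⱼ≠0 i<j ]
               ≈ 1# * kernelAt (x i) (x j)
  factor-x i<j = kernelAt-unique (λ { ≡.refl → ℕ.<-irrefl ≡.refl i<j }) (trans (÷-*-cancel _ _) (sym (*-identityˡ _)))

  normalized-numerator : ∀ a → t½^ (ℤ.- + 1) - t½^ (+ 1) * a ≈ gen⁻¹ t½ * (1# - t * a)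
  normalized-numerator a = begin
    gen⁻¹ t½ * 1# - gen t½ * 1# * a         ≈⟨ +-congˡ (-‿cong (*-congʳ (trans (sym (*-identityˡ _)) (*-congʳ (sym (trans (*-comm _ _) (gen-inverse t½))))))) ⟩
    gen⁻¹ t½ * 1# - gen⁻¹ t½ * gen t½ * (gen t½ * 1#) * a
                                            ≈⟨ +-congˡ (-‿cong (trans (*-congʳ (*-assoc _ _ _)) (*-assoc _ _ _))) ⟩
    gen⁻¹ t½ * 1# - gen⁻¹ t½ * (t * a)      ≈⟨ x[y-z]≈xy-xz _ _ _ ⟨
    gen⁻¹ t½ * (1# - t * a)                 ∎

  factor-cˣ : ∀ {i j} (i<j : i Fin.< j) →
              (t½^ (ℤ.- + 1) - t½^ (+ 1) * (gen⁻¹ (x i) * gen (x j))) ÷ (1# - gen⁻¹ (x i) * gen (x j)) [ 1-xᵢ⁻¹xⱼ≠0 i<j ]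
                ≈ gen⁻¹ t½ * kernelAt (x i) (x j)
  factor-cˣ i<j = kernelAt-unique (λ { ≡.refl → ℕ.<-irrefl ≡.refl i<j }) (trans (÷-*-cancel _ _) (normalized-numerator _))

  -- The inverse sits on the second index here, so the kernel is taken at (Y_j, Y_i), with the
  -- indices exchanged.
  factor-cʸ : ∀ {i j} (i<j : i Fin.< j) →
              (t½^ (ℤ.- + 1) - t½^ (+ 1) * (gen (Y i) * gen⁻¹ (Y j))) ÷ (1# - gen (Y i) * gen⁻¹ (Y j)) [ 1-YᵢYⱼ⁻¹≠0 i<j ]
                ≈ gen⁻¹ t½ * kernelAt (Y j) (Y i)
  factor-cʸ {i} {j} i<j = kernelAt-unique (λ { ≡.refl → ℕ.<-irrefl ≡.refl i<j }) (begin
    f * (1# - gen⁻¹ (Y j) * gen (Y i))                        ≈⟨ *-congˡ (+-congˡ (-‿cong (*-comm _ _))) ⟩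
    f * (1# - gen (Y i) * gen⁻¹ (Y j))                        ≈⟨ ÷-*-cancel _ _ ⟩
    t½^ (ℤ.- + 1) - t½^ (+ 1) * (gen (Y i) * gen⁻¹ (Y j))     ≈⟨ normalized-numerator _ ⟩
    gen⁻¹ t½ * (1# - t * (gen (Y i) * gen⁻¹ (Y j)))           ≈⟨ *-congˡ (+-congˡ (-‿cong (*-congˡ (*-comm _ _)))) ⟩
    gen⁻¹ t½ * (1# - t * (gen⁻¹ (Y j) * gen (Y i)))           ∎)
    where
    f : Carrier
    f = (t½^ (ℤ.- + 1) - t½^ (+ 1) * (gen (Y i) * gen⁻¹ (Y j))) ÷ (1# - gen (Y i) * gen⁻¹ (Y j)) [ 1-YᵢYⱼ⁻¹≠0 i<j ]

  -- The ratio (1 - t^{d+1})/(1 - t^d) for d ≥ 1, made total so that it applies to the truncated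
  -- difference of any two indices.
  q : ℕ → Carrier
  q zero    = 1#
  q (suc d) = (1# - t ^ suc (suc d)) ÷ (1# - t ^ suc d) [ 1-t^≠0 (suc d) (s≤s z≤n) ]

  q-ratio : ∀ d → q (suc d) * (1# - t ^ suc d) ≈ 1# - t ^ suc (suc d)
  q-ratio d = ÷-*-cancel _ _

  factor-q : ∀ d (0<d : 0 ℕ.< d) → (1# - t ^ suc d) ÷ (1# - t ^ d) [ 1-t^≠0 d 0<d ] ≈ q d
  factor-q (suc d) (s≤s z≤n) = refl

  -- The last factor (1 - t^{m+1})/(1 - t) is split off, because it is the geometric sum.
  []!-suc : ∀ m → [ suc m ]! ≈ geometric (suc m) * [ m ]!
  []!-suc m = begin
    [ suc m ]!
      ≈⟨ Prod.sum-init-last {m} (λ d → (1# - t ^ suc (toℕ d)) ÷ (1# - t) [ 1-t≠0 ]) ⟩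
    Prod.sum {m} (λ d → (1# - t ^ suc (toℕ (Fin.inject₁ d))) ÷ (1# - t) [ 1-t≠0 ]) * ((1# - t ^ suc (toℕ (Fin.fromℕ m))) ÷ (1# - t) [ 1-t≠0 ])
      ≈⟨ *-cong (Prod.sum-cong-≋ {m} λ d → *-congʳ (+-congˡ (-‿cong (reflexive (≡.cong (λ e → t ^ suc e) (Fin.toℕ-inject₁ d))))))
                (*-cancelʳ-nonZero 1-t≠0 last-factor) ⟩
    [ m ]! * geometric (suc m)
      ≈⟨ *-comm _ _ ⟩
    geometric (suc m) * [ m ]! ∎
    where
    last-factor : ((1# - t ^ suc (toℕ (Fin.fromℕ m))) ÷ (1# - t) [ 1-t≠0 ]) * (1# - t) ≈ geometric (suc m) * (1# - t)
    last-factor = begin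
      ((1# - t ^ suc (toℕ (Fin.fromℕ m))) ÷ (1# - t) [ 1-t≠0 ]) * (1# - t)  ≈⟨ ÷-*-cancel _ _ ⟩
      1# - t ^ suc (toℕ (Fin.fromℕ m))                                      ≡⟨ ≡.cong (λ d → 1# - t ^ suc d) (Fin.toℕ-fromℕ m) ⟩
      1# - t ^ suc m                                                        ≈⟨ geometric-closed (suc m) ⟨
      (1# - t) * geometric (suc m)                                          ≈⟨ *-comm _ _ ⟩
      geometric (suc m) * (1# - t)                                          ∎

  -- Powers of t^{1/2} and the point ev_0.

  t½^-suc : ∀ k → t½^ (ℤ.suc k) ≈ gen t½ * t½^ k
  t½^-suc (+ k)            = refl
  t½^-suc -[1+ zero ]      = sym (trans (*-congˡ (*-identityʳ _)) (gen-inverse t½))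
  t½^-suc -[1+ suc k ]     = sym (trans (sym (*-assoc _ _ _)) (trans (*-congʳ (gen-inverse t½)) (*-identityˡ _)))

  t½^-+ : ∀ m k → t½^ (+ m ℤ.+ k) ≈ gen t½ ^ m * t½^ k
  t½^-+ zero    k = trans (reflexive (≡.cong t½^_ (ℤ.+-identityˡ k))) (sym (*-identityˡ _))
  t½^-+ (suc m) k = begin
    t½^ (+ suc m ℤ.+ k)             ≡⟨ ≡.cong t½^_ (ℤ.suc-+ m k) ⟩
    t½^ (ℤ.suc (+ m ℤ.+ k))         ≈⟨ t½^-suc (+ m ℤ.+ k) ⟩
    gen t½ * t½^ (+ m ℤ.+ k)        ≈⟨ *-congˡ (t½^-+ m k) ⟩
    gen t½ * (gen t½ ^ m * t½^ k)   ≈⟨ *-assoc _ _ _ ⟨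
    gen t½ ^ suc m * t½^ k          ∎

  t½^-neg : ∀ k → t½^ (ℤ.- + k) ≈ gen⁻¹ t½ ^ k
  t½^-neg zero    = refl
  t½^-neg (suc k) = refl

  nonZero-^ : ∀ {f} → NonZero f → ∀ m → NonZero (f ^ m)
  nonZero-^ nz zero    = regular-1
  nonZero-^ {f} nz (suc m) = nonZero-* {f} {f ^ m} nz (nonZero-^ {f} nz m)

  t½^≠0 : ∀ k → NonZero (t½^ k)
  t½^≠0 (+ k)    = nonZero-^ {gen t½} (gen≠0 t½) k
  t½^≠0 -[1+ k ] = nonZero-^ {gen⁻¹ t½} (invertible⇒nonZero {gen⁻¹ t½} {gen t½} (trans (*-comm _ _) (gen-inverse t½))) (suc k)

  -- The common shift (n-1)/2 cancels between Y_i and Y_j, leaving t^{j-i}; the computation is done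
  -- with exponents of t^{1/2}, hence the factors 2.
  ev₀-Y-ratio : ∀ {i j} → i Fin.≤ j → ev₀ (Y i) ≈ t ^ (toℕ j ℕ.∸ toℕ i) * ev₀ (Y j)
  ev₀-Y-ratio {i} {j} i≤j = begin
    t½^ (+ (n ℕ.∸ 1) ℤ.- + (2 ℕ.* toℕ i))                                ≡⟨ ≡.cong t½^_ exponent ⟩
    t½^ (+ (2 ℕ.* d) ℤ.+ (+ (n ℕ.∸ 1) ℤ.- + (2 ℕ.* toℕ j)))              ≈⟨ t½^-+ (2 ℕ.* d) (a ℤ.- + (2 ℕ.* toℕ j)) ⟩
    gen t½ ^ (2 ℕ.* d) * ev₀ (Y j)                                       ≈⟨ *-congʳ (^-assocʳ (gen t½) 2 d) ⟨
    t ^ d * ev₀ (Y j)                                                    ∎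
    where
    d = toℕ j ℕ.∸ toℕ i
    a b e : ℤ
    a = + (n ℕ.∸ 1)
    b = + (2 ℕ.* toℕ i)
    e = + (2 ℕ.* d)

    2j : 2 ℕ.* toℕ j ≡ 2 ℕ.* d ℕ.+ 2 ℕ.* toℕ i
    2j = ≡.trans (≡.cong (2 ℕ.*_) (≡.sym (ℕ.m∸n+n≡m i≤j))) (ℕ.*-distribˡ-+ 2 d (toℕ i))

    exponent : a ℤ.- b ≡ e ℤ.+ (a ℤ.- + (2 ℕ.* toℕ j))
    exponent = ≡.sym (≡.trans (≡.cong (λ m → e ℤ.+ (a ℤ.- + m)) 2j) (cancel-e a b e))
      where
      cancel-e : ∀ a b e → e ℤ.+ (a ℤ.- (e ℤ.+ b)) ≡ a ℤ.- b
      cancel-e = solve-∀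

  -- Values of rational functions at a point.

  infix 4 _[_]↦_
  -- Bundles being defined at ρ with having a given value there; as a relation it is compatible with
  -- products, so both can be checked factor by factor.
  _[_]↦_ : Carrier → (Var n → Carrier) → Carrier → Set _
  f [ ρ ]↦ v = Σ (DefinedAt ρ f) λ d → DefinedAt.value d ≈ v

  ↦-intro : ∀ {ρ f v} (p : Fraction) → f ≈ p → NonZero (eval ρ (den p)) → eval ρ (num p) ≈ v * eval ρ (den p) → f [ ρ ]↦ v
  ↦-intro p f≈p nz e = record { fraction = p ; represents = f≈p ; nonvanishing = nz } ,
    *-cancelʳ-nonZero nz (trans (÷-*-cancel _ _) e)

  ↦-resp : ∀ {ρ f g v} → f ≈ g → g [ ρ ]↦ v → f [ ρ ]↦ v
  ↦-resp e (d , v) = record { fraction = fraction ; represents = trans e represents ; nonvanishing = nonvanishing } , v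
    where open DefinedAt d

  ↦-1 : ∀ {ρ} → 1# [ ρ ]↦ 1#
  ↦-1 = ↦-intro 1# refl regular-1 (sym (*-identityˡ 1#))

  ↦-* : ∀ {ρ f g v w} → f [ ρ ]↦ v → g [ ρ ]↦ w → (f * g) [ ρ ]↦ (v * w)
  ↦-* {ρ} {f} {g} {v} {w} (d , dv) (e , ew) = ↦-intro (d.fraction * e.fraction) (*-cong d.represents e.represents)
    (nonZero-cong (sym den-value) (nonZero-* {eval ρ (den d.fraction)} {eval ρ (den e.fraction)} d.nonvanishing e.nonvanishing))
    (begin
      eval ρ (num (d.fraction * e.fraction))
        ≡⟨ ≡.cong (eval ρ) (num-* d.fraction e.fraction) ⟩
      eval ρ (num d.fraction) * eval ρ (num e.fraction)
        ≈⟨ *-cong (numerator d dv) (numerator e ew) ⟩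
      v * eval ρ (den d.fraction) * (w * eval ρ (den e.fraction))
        ≈⟨ interchange _ _ _ _ ⟩
      v * w * (eval ρ (den d.fraction) * eval ρ (den e.fraction))
        ≈⟨ *-congˡ den-value ⟨
      v * w * eval ρ (den (d.fraction * e.fraction)) ∎)
    where
    module d = DefinedAt d
    module e = DefinedAt e
    den-value : eval ρ (den (d.fraction * e.fraction)) ≈ eval ρ (den d.fraction) * eval ρ (den e.fraction)
    den-value = reflexive (≡.cong (eval ρ) (den-* d.fraction e.fraction))
    numerator : ∀ {f v} (d : DefinedAt ρ f) → DefinedAt.value d ≈ v →
                eval ρ (num (DefinedAt.fraction d)) ≈ v * eval ρ (den (DefinedAt.fraction d))
    numerator d dv = trans (sym (÷-*-cancel _ _ {DefinedAt.nonvanishing d})) (*-congʳ dv)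

  ↦-sum : ∀ {ρ m} {f v : Fin m → Carrier} → (∀ i → f i [ ρ ]↦ v i) → Prod.sum f [ ρ ]↦ Prod.sum v
  ↦-sum {m = zero}  e = ↦-1
  ↦-sum {m = suc m} e = ↦-* (e zero) (↦-sum (e ∘ suc))

  ↦-pairs : ∀ {ρ} (lam : Vector ℤ n) {f v : Fin n → Fin n → Carrier} →
            (∀ i j → i Fin.< j → f i j [ ρ ]↦ v i j) → Prod.sum-pairs lam f [ ρ ]↦ Prod.sum-pairs lam v
  ↦-pairs {ρ} lam {f} {v} e = ↦-sum λ i → ↦-sum λ j → entry i j (i Fin.<? j) (lam i ℤ.≟ lam j)
    where
    entry : ∀ i j (d : Dec (i Fin.< j)) (d′ : Dec (lam i ≡ lam j)) →
            (Prod.[ does d ∧ does d′ ]· f i j) [ ρ ]↦ (Prod.[ does d ∧ does d′ ]· v i j)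
    entry i j (yes i<j) (yes _) = e i j i<j
    entry i j (yes _)   (no _)  = ↦-1
    entry i j (no _)    _       = ↦-1

  ↦-gen⁻¹-t½ : gen⁻¹ t½ [ ev₀ ]↦ gen⁻¹ t½
  ↦-gen⁻¹-t½ = ↦-intro (gen⁻¹ t½) refl (gen≠0 t½) (sym (trans (*-comm _ _) (gen-inverse t½)))

  -- At ev_0 one has Y_i = t^d Y_j with d = j - i > 0, so the power Y_j of t^{1/2} cancels from (Y_j
  -- - t Y_i)/(Y_j - Y_i).
  ↦-kernelAt : ∀ {i j} → i Fin.< j → kernelAt (Y j) (Y i) [ ev₀ ]↦ q (toℕ j ℕ.∸ toℕ i)
  ↦-kernelAt {i} {j} i<j = ↦-intro p represents
    (nonZero-cong (sym difference) (nonZero-* {1# - t ^ d} {ev₀ (Y j)} (1-t^≠0 d 0<d) (t½^≠0 (+ (n ℕ.∸ 1) ℤ.- + (2 ℕ.* toℕ j)))))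
    (sym (begin
      q d * (ev₀ (Y j) - ev₀ (Y i))             ≈⟨ *-congˡ difference ⟩
      q d * ((1# - t ^ d) * ev₀ (Y j))          ≈⟨ *-assoc _ _ _ ⟨
      q d * (1# - t ^ d) * ev₀ (Y j)            ≈⟨ *-congʳ (trans (*-congʳ (sym (factor-q d 0<d))) (÷-*-cancel _ _)) ⟩
      (1# - t * t ^ d) * ev₀ (Y j)              ≈⟨ trans ([y-z]x≈yx-zx _ _ _) (+-cong (*-identityˡ _) (-‿cong (*-assoc _ _ _))) ⟩
      ev₀ (Y j) - t * (t ^ d * ev₀ (Y j))       ≈⟨ +-congˡ (-‿cong (*-congˡ (ev₀-Y-ratio (ℕ.<⇒≤ i<j)))) ⟨
      ev₀ (Y j) - t * ev₀ (Y i)                 ∎))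
    where
    d = toℕ j ℕ.∸ toℕ i
    0<d : 0 ℕ.< d
    0<d = m<n⇒0<n∸m i<j

    Yᵢ≢Yⱼ : Y i ≢ Y j
    Yᵢ≢Yⱼ ≡.refl = ℕ.<-irrefl ≡.refl i<j

    ι-difference : ∀ a b → ι a - ι b ≈ ι (a R.- b)
    ι-difference a b = trans (+-congˡ (sym (ι.-‿homo b))) (sym (ι.+-homo a (R.- b)))

    -- Written in the shape to which `t` unfolds, so that its evaluation at `ev₀` is `t` by
    -- computation.
    t-poly : R.Carrier
    t-poly = var t½ R.* (var t½ R.* R.1#)

    -- An explicit quotient of polynomials representing the kernel, whose numerator and denominator
    -- evaluate by computation.
    p : Fraction
    p = (var (Y j) R.- t-poly R.* var (Y i)) / (var (Y j) R.- var (Y i))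
          [ nonZero-cong (ι-difference (var (Y j)) (var (Y i))) (gen-gen≠0 Yᵢ≢Yⱼ) ]

    represents : kernelAt (Y j) (Y i) ≈ p
    represents = *-cancelʳ-nonZero (gen-gen≠0 Yᵢ≢Yⱼ) (begin
      kernelAt (Y j) (Y i) * (gen (Y j) - gen (Y i))  ≈⟨ kernelAt-ratio Yᵢ≢Yⱼ ⟩
      gen (Y j) - t * gen (Y i)                       ≈⟨ +-congˡ (-‿cong (*-congʳ (*-congˡ (sym (ι.*-homo (var t½) R.1#))))) ⟩
      gen (Y j) - gen t½ * ι (var t½ R.* R.1#) * gen (Y i)
                                                      ≈⟨ +-congˡ (-‿cong (trans (ι.*-homo t-poly (var (Y i))) (*-congʳ (ι.*-homo (var t½) (var t½ R.* R.1#))))) ⟨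
      gen (Y j) - ι (t-poly R.* var (Y i))            ≈⟨ ι-difference _ _ ⟩
      ι (num p)                                       ≈⟨ *-den p ⟨
      p * ι (den p)                                   ≈⟨ *-congˡ (ι-difference _ _) ⟨
      p * (gen (Y j) - gen (Y i))                     ∎)

    difference : ev₀ (Y j) - ev₀ (Y i) ≈ (1# - t ^ d) * ev₀ (Y j)
    difference = begin
      ev₀ (Y j) - ev₀ (Y i)                   ≈⟨ +-cong (sym (*-identityˡ _)) (-‿cong (ev₀-Y-ratio (ℕ.<⇒≤ i<j))) ⟩
      1# * ev₀ (Y j) - t ^ d * ev₀ (Y j)      ≈⟨ [y-z]x≈yx-zx _ _ _ ⟨
      (1# - t ^ d) * ev₀ (Y j)                ∎

  -- Assembling the identities.

  module _ {lam : Vector ℤ n} (dom : Dominant lam) where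

    private
      q-product : Carrier
      q-product = Prod.sum-pairs lam λ i j → q (toℕ j ℕ.∸ toℕ i)

    ∑-stabilizer-∏< : ∀ {f} a → (∀ w → w · a ≈ a) → (∀ i j (i<j : i Fin.< j) → f i j i<j ≈ a * kernelAt (x i) (x j)) →
                      ∑[ w ∈ stabilizer lam ] (w · ∏< lam f) ≈ a ^ maxLength dom * poincaré lam
    ∑-stabilizer-∏< {f} a wa e = begin
      ∑[ w ∈ stabilizer lam ] (w · ∏< lam f)
        ≈⟨ Sum.∑-cong (stabilizer lam) (λ w → ·-∏< w lam a (wa w) e) ⟩
      ∑[ w ∈ stabilizer lam ] (Prod.sum-pairs lam (λ _ _ → a) * Prod.sum-pairs lam λ i j → kernelAt (x (w ⟨$⟩ʳ i)) (x (w ⟨$⟩ʳ j)))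
        ≈⟨ *-distribˡ-∑ (Prod.sum-pairs lam λ _ _ → a) (stabilizer lam) _ ⟨
      Prod.sum-pairs lam (λ _ _ → a) * (∑[ w ∈ stabilizer lam ] Prod.sum-pairs lam λ i j → kernelAt (x (w ⟨$⟩ʳ i)) (x (w ⟨$⟩ʳ j)))
        ≈⟨ *-cong (∏-pairs-const dom a) (sum-symmetrized dom kernel-x) ⟩
      a ^ maxLength dom * poincaré lam ∎

    t½^-longest : t½^ (ℤ.- + ℓ (longest lam)) ≈ gen⁻¹ t½ ^ maxLength dom
    t½^-longest = trans (t½^-neg (ℓ (longest lam))) (reflexive (≡.cong (gen⁻¹ t½ ^_) (ℓ-longest dom)))

    cʸ-at-ev₀ : cʸ lam [ ev₀ ]↦ (gen⁻¹ t½ ^ maxLength dom * poincaré lam)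
    cʸ-at-ev₀ = ↦-resp (∏<-pairs lam λ i j → factor-cʸ) (proj₁ value , trans (proj₂ value) (begin
      Prod.sum-pairs lam (λ i j → gen⁻¹ t½ * q (toℕ j ℕ.∸ toℕ i))
        ≈⟨ Prod.sum-pairs-∙ lam (λ _ _ → gen⁻¹ t½) (λ i j → q (toℕ j ℕ.∸ toℕ i)) ⟩
      Prod.sum-pairs lam (λ _ _ → gen⁻¹ t½) * q-product
        ≈⟨ *-cong (∏-pairs-const dom (gen⁻¹ t½)) (sym (poincaré-pairs dom q q-ratio)) ⟩
      gen⁻¹ t½ ^ maxLength dom * poincaré lam ∎))
      where
      value : Prod.sum-pairs lam (λ i j → gen⁻¹ t½ * kernelAt (Y j) (Y i)) [ ev₀ ]↦
              Prod.sum-pairs lam (λ i j → gen⁻¹ t½ * q (toℕ j ℕ.∸ toℕ i))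
      value = ↦-pairs lam λ i j i<j → ↦-* ↦-gen⁻¹-t½ (↦-kernelAt i<j)

proposition4p6 : ∀ {c ℓ′} (K : CommutativeRing c ℓ′) (n : ℕ) → 1 ℕ.≤ n →
    (lam : Vector ℤ n) → Dominant lam →
    let open RationalFunctions K n in
    (Σ (DefinedAt ev₀ (cʸ lam)) λ ev →
    (t½^ (ℤ.- + ℓ (longest lam)) * poincaré lam ≈ DefinedAt.value ev)
    × (DefinedAt.value ev ≈ ∑[ w ∈ stabilizer lam ] (w · cˣ lam)))
    × (poincaré lam
    ≈ ∑[ w ∈ stabilizer lam ] (w · ∏< lam λ i j i<j →
    (1# - t * (gen⁻¹ (x i) * gen (x j))) ÷ (1# - gen⁻¹ (x i) * gen (x j)) [ 1-xᵢ⁻¹xⱼ≠0 i<j ]))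
    × (poincaré lam
    ≈ ∏< lam λ i j i<j →
    (1# - t ^ suc (toℕ j ℕ.∸ toℕ i)) ÷ (1# - t ^ (toℕ j ℕ.∸ toℕ i)) [ 1-t^≠0 (toℕ j ℕ.∸ toℕ i) (m<n⇒0<n∸m i<j) ])
    × (poincaré lam ≈ ∏ᶻ (λ i → [ multiplicity lam i ]!) ([multiplicity]!-support lam))
proposition4p6 K n _ lam dom =
    ( proj₁ (cʸ-at-ev₀ dom)
    , trans (*-congʳ (t½^-longest dom)) (sym (proj₂ (cʸ-at-ev₀ dom)))
    , trans (proj₂ (cʸ-at-ev₀ dom))
        (sym (∑-stabilizer-∏< dom (gen⁻¹ t½) (λ w → ·-gen⁻¹ w t½) λ i j → factor-cˣ)) )
  , sym (trans (∑-stabilizer-∏< dom 1# ·-1 λ i j → factor-x) (trans (*-congʳ (1^ (maxLength dom))) (*-identityˡ _)))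
  , trans (poincaré-pairs dom q q-ratio)
      (sym (∏<-pairs lam λ i j i<j → factor-q (toℕ j ℕ.∸ toℕ i) (m<n⇒0<n∸m i<j)))
  , poincaré-multiplicities dom [_]! refl []!-suc (FiniteSupport.support-unique support)
      (λ i → Mem.∈-deduplicate⁺ ℤ._≟_ (Mem.∈-tabulate⁺ {f = lam} i))
  where
  open RationalFunctions K n hiding (zero)
  open RationalFunctionProperties K n
  open StabilizerIdentities fractionRing t cancel-1-t
  support = [multiplicity]!-support lam
  1^ : ∀ m → 1# ^ m ≈ 1#
  1^ zero    = refl
  1^ (suc m) = trans (*-identityˡ _) (1^ m)
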